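{- Let $k\ge 1$, let $1<m_1<m_2<\cdots<m_k$ be distinct positive integers, and let $a_1,\dots,a_k$ be integers such that every integer $z$ satisfies $z\equiv a_j \pmod{m_j}$ for at least one $j\in\{1,\dots,k\}$ (i.e. the congruences form a distinct covering system). Then $m_1\le 10^{18}$. -}

module Defs where

open import Data.Nat using (ℕ; suc; _<_)
open import Data.Integer using (ℤ; +_; _-_)
open import Data.Integer.Divisibility using (_∣_)
open import Data.Fin using (Fin; _<_; zero)
open import Data.Product using (∃)

StrictlyIncreasing : {k : ℕ} → (Fin k → ℕ) → Set
StrictlyIncreasing {k} m = ∀ (i j : Fin k) → i Data.Fin.< j → m i Data.Nat.< m j

Covers : {k : ℕ} → (Fin k → ℕ) → (Fin k → ℤ) → Set
Covers {k} m a = ∀ (z : ℤ) → ∃ λ (j : Fin k) → (+ m j) ∣ (z - a j)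

{-# OPTIONS --safe #-}

-- The distortion method of Balister, Bollobás, Morris, Sahasrabudhe and Tiba.
-- The primes are treated in increasing order; the integers modulo Q, the product of the
-- prime powers p ^ G treated so far, carry a measure, and x modulo Q * p ^ G is written
-- y + Q * t with t < p ^ G.  Suppose that all moduli exceed 10¹⁸.  For the primes below
-- 12600 the measure is uniform, and Rankin's trick, with the bound 1 ≤ (d / 10¹⁸)^(1/3)
-- for the moduli d, shows that the progressions with 12600-smooth moduli cover at most
-- 26 percent.  They are discarded.  At each later prime p the points covered by the
-- progressions whose modulus has largest prime factor p are discarded too, and the rest of
-- each fibre is scaled up by at most 6/5 to make up for it; the mass lost is at most 9/5
-- times the second moment of the covered proportion α of a fibre.
--
-- The second moment is at most (C / K) / (p - 1)², where C / K bounds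
-- E[#{m : x ≡ r m mod m} * #{m : x ≡ r′ m mod m}], m running over the divisors of Q, for all
-- choices r, r′ of one residue per modulus; splitting m by the power of p shows that this
-- bound grows by a factor 1 + (6/5) (3p - 1) / (p - 1)² at p.  As primes are coprime to
-- 210, comparing with (3/5) / #{j < n : gcd j 210 = 1} shows that the total mass lost at
-- the primes from 12600 on is less than what was left.
--
-- All quantities are natural numbers: measures are not normalised, N is the nominal total
-- mass, and bounds are stated as K * E … ≤ C * N.
module Submission where

open import Defs
open import Data.Nat using (ℕ; suc; _<_; _≤_; _^_)
open import Data.Integer using (ℤ)
open import Data.Fin using (Fin; zero)

open import Data.Bool using (Bool; true; false; T; _∧_; _∨_; if_then_else_)
open import Data.Bool.ListAction using (all)
open import Data.Bool.Properties using (T-∧; T-∨)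
import Data.Fin as Fin
import Data.Fin.Properties as Fin
open import Data.Fin using (fromℕ)
import Data.Integer as ℤ
open import Data.Integer using () renaming (+_ to pos)
import Data.Integer.Divisibility.Signed as ℤ
import Data.Integer.Properties as ℤ
import Data.Integer.Tactic.RingSolver as ℤ
open import Data.List using (List; []; _∷_; _++_; map; concatMap; upTo; downFrom; cartesianProductWith)
open import Data.List.Membership.Propositional using (_∈_; lose; find)
open import Data.List.Membership.Propositional.Properties using (∈-downFrom⁻; ∈-downFrom⁺; ∈-map⁻; ∈-concatMap⁻; ∈-cartesianProductWith⁻; ∈-cartesianProductWith⁺)
open import Data.List.Relation.Unary.All using (_∷_)
open import Data.List.Relation.Unary.Any using (here; there; any?)
open import Data.Nat hiding (ℕ; suc; _<_; _≤_; _^_; zero)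
open import Data.Nat using (zero)
open import Data.Nat.DivMod using (m≡m%n+[m/n]*n; m%n<n; [m+kn]%n≡m%n)
open import Data.Nat.Divisibility using (_∣_; _∣?_; ∣-refl; ∣-trans; ∣⇒≤; m∣m*n; n∣m*n; *-pres-∣; divides; 1∣_; *-monoˡ-∣; *-cancelˡ-∣; m%n≡0⇒n∣m; ∣1⇒≡1)
open import Data.Nat.Induction using (<-rec)
open import Data.Nat.ListAction using (product)
open import Data.Nat.Primality using (Prime; prime?; euclidsLemma; prime⇒nonZero; prime⇒nonTrivial; prime⇒irreducible; ¬prime[1])
open import Data.Nat.Primality.Factorisation using (factorise)
open import Data.Nat.Properties
open import Data.Nat.Tactic.RingSolver using (solve-∀)
open import Data.Product using (_×_; _,_; proj₁; proj₂; ∃-syntax)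
open import Data.Sum using (_⊎_; inj₁; inj₂; [_,_])
open import Function using (_∘_; Equivalence; it)
open import Relation.Binary.Definitions using (tri<; tri≈; tri>)
open import Relation.Binary.PropositionalEquality hiding ([_])
open import Relation.Nullary using (Dec; yes; no; ¬_; contradiction)
open import Relation.Nullary.Decidable using (_×-dec_; toWitness)
open import Relation.Unary using (Decidable)

private
  variable
    A B : Set
    P R : Set

*-swap : ∀ x y z → x * (y * z) ≡ y * (x * z)
*-swap = solve-∀

-- Finite sums

∑ : List A → (A → ℕ) → ℕ
∑ []       f = 0
∑ (x ∷ xs) f = f x + ∑ xs f

∑-cong : ∀ (xs : List A) {f g} → (∀ x → f x ≡ g x) → ∑ xs f ≡ ∑ xs g
∑-cong []       h = refl
∑-cong (x ∷ xs) h = cong₂ _+_ (h x) (∑-cong xs h)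

∑-mono-∈ : ∀ (xs : List A) {f g} → (∀ {x} → x ∈ xs → f x ≤ g x) → ∑ xs f ≤ ∑ xs g
∑-mono-∈ []       h = z≤n
∑-mono-∈ (x ∷ xs) h = +-mono-≤ (h (here refl)) (∑-mono-∈ xs (h ∘ there))

∑-mono : ∀ (xs : List A) {f g} → (∀ x → f x ≤ g x) → ∑ xs f ≤ ∑ xs g
∑-mono xs h = ∑-mono-∈ xs (λ {x} _ → h x)

∑-zero : ∀ (xs : List A) → ∑ xs (λ _ → 0) ≡ 0
∑-zero []       = refl
∑-zero (x ∷ xs) = ∑-zero xs

+-interchange : ∀ a b c d → (a + b) + (c + d) ≡ (a + c) + (b + d)
+-interchange = solve-∀

∑-+ : ∀ (xs : List A) f g → ∑ xs (λ x → f x + g x) ≡ ∑ xs f + ∑ xs g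
∑-+ []       f g = refl
∑-+ (x ∷ xs) f g = trans (cong (f x + g x +_) (∑-+ xs f g)) (+-interchange (f x) (g x) _ _)

∑-*ˡ : ∀ (xs : List A) c f → ∑ xs (λ x → c * f x) ≡ c * ∑ xs f
∑-*ˡ []       c f = sym (*-zeroʳ c)
∑-*ˡ (x ∷ xs) c f = trans (cong (c * f x +_) (∑-*ˡ xs c f)) (sym (*-distribˡ-+ c (f x) _))

∑-*ʳ : ∀ (xs : List A) c f → ∑ xs (λ x → f x * c) ≡ ∑ xs f * c
∑-*ʳ xs c f = trans (∑-cong xs (λ x → *-comm (f x) c)) (trans (∑-*ˡ xs c f) (*-comm c _))

∑-++ : ∀ (xs ys : List A) f → ∑ (xs ++ ys) f ≡ ∑ xs f + ∑ ys f
∑-++ []       ys f = refl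
∑-++ (x ∷ xs) ys f = trans (cong (f x +_) (∑-++ xs ys f)) (sym (+-assoc (f x) _ _))

∑-map : ∀ (h : A → B) xs f → ∑ (map h xs) f ≡ ∑ xs (f ∘ h)
∑-map h []       f = refl
∑-map h (x ∷ xs) f = cong (f (h x) +_) (∑-map h xs f)

∑-concatMap : ∀ (h : A → List B) xs f → ∑ (concatMap h xs) f ≡ ∑ xs (λ x → ∑ (h x) f)
∑-concatMap h []       f = refl
∑-concatMap h (x ∷ xs) f =
  trans (∑-++ (h x) (concatMap h xs) f) (cong (∑ (h x) f +_) (∑-concatMap h xs f))

∑-cartesianProductWith : ∀ {C : Set} (h : A → B → C) xs ys f →
  ∑ (cartesianProductWith h xs ys) f ≡ ∑ xs (λ x → ∑ ys (λ y → f (h x y)))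
∑-cartesianProductWith h []       ys f = refl
∑-cartesianProductWith h (x ∷ xs) ys f =
  trans (∑-++ (map (h x) ys) _ f)
        (cong₂ _+_ (∑-map (h x) ys f) (∑-cartesianProductWith h xs ys f))

∑-swap : ∀ (xs : List A) (ys : List B) (f : A → B → ℕ) →
  ∑ xs (λ x → ∑ ys (f x)) ≡ ∑ ys (λ y → ∑ xs (λ x → f x y))
∑-swap []       ys f = sym (∑-zero ys)
∑-swap (x ∷ xs) ys f =
  trans (cong (∑ ys (f x) +_) (∑-swap xs ys f)) (sym (∑-+ ys (f x) _))

∑-*-∑ : ∀ (xs : List A) (ys : List B) f g →
  ∑ xs f * ∑ ys g ≡ ∑ xs (λ x → ∑ ys (λ y → f x * g y))
∑-*-∑ xs ys f g =
  trans (sym (∑-*ʳ xs (∑ ys g) f)) (∑-cong xs (λ x → sym (∑-*ˡ ys (f x) g)))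

∑-downFrom-+ : ∀ m n f → ∑ (downFrom (m + n)) f ≡ ∑ (downFrom m) (λ i → f (i + n)) + ∑ (downFrom n) f
∑-downFrom-+ zero    n f = refl
∑-downFrom-+ (suc m) n f =
  trans (cong (f (m + n) +_) (∑-downFrom-+ m n f)) (sym (+-assoc (f (m + n)) _ _))

∑-downFrom-last : ∀ n f → ∑ (downFrom (suc n)) f ≡ ∑ (downFrom n) (f ∘ suc) + f 0
∑-downFrom-last zero    f = +-identityʳ (f 0)
∑-downFrom-last (suc n) f =
  trans (cong (f (suc n) +_) (∑-downFrom-last n f)) (sym (+-assoc (f (suc n)) _ _))

∑-downFrom-mono-range : ∀ {m n} f → m ≤ n → ∑ (downFrom m) f ≤ ∑ (downFrom n) f
∑-downFrom-mono-range {m} {n} f m≤n = begin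
  ∑ (downFrom m) f                                              ≤⟨ m≤n+m _ _ ⟩
  ∑ (downFrom (n ∸ m)) (λ i → f (i + m)) + ∑ (downFrom m) f     ≡⟨ ∑-downFrom-+ (n ∸ m) m f ⟨
  ∑ (downFrom (n ∸ m + m)) f                                    ≡⟨ cong (λ k → ∑ (downFrom k) f) (m∸n+n≡m m≤n) ⟩
  ∑ (downFrom n) f                                              ∎
  where open ≤-Reasoning

∑-const : ∀ n c → ∑ (downFrom n) (λ _ → c) ≡ n * c
∑-const zero    c = refl
∑-const (suc n) c = cong (c +_) (∑-const n c)

-- Indicator functions

𝟙 : Dec P → ℕ
𝟙 (yes _) = 1
𝟙 (no  _) = 0

𝟙-mono : (p : Dec P) (r : Dec R) → (P → R) → 𝟙 p ≤ 𝟙 r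
𝟙-mono (no  _) _        _ = z≤n
𝟙-mono (yes _) (yes _)  _ = ≤-refl
𝟙-mono (yes p) (no  ¬r) f = contradiction (f p) ¬r

𝟙≤1 : (p : Dec P) → 𝟙 p ≤ 1
𝟙≤1 (yes _) = ≤-refl
𝟙≤1 (no  _) = z≤n

𝟙-yes : (p : Dec P) → P → 𝟙 p ≡ 1
𝟙-yes (yes _)  _ = refl
𝟙-yes (no  ¬p) p = contradiction p ¬p

𝟙-no : (p : Dec P) → ¬ P → 𝟙 p ≡ 0
𝟙-no (yes p) ¬p = contradiction p ¬p
𝟙-no (no  _) _  = refl

-- The union bound.
𝟙-any : ∀ {P : A → Set} (P? : Decidable P) xs → 𝟙 (any? P? xs) ≤ ∑ xs (𝟙 ∘ P?)
𝟙-any P? []       = z≤n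
𝟙-any P? (x ∷ xs) with P? x
... | yes _ = s≤s z≤n
... | no  _ with any? P? xs in eq
...   | yes _ = subst (_≤ ∑ xs (𝟙 ∘ P?)) (cong 𝟙 eq) (𝟙-any P? xs)
...   | no  _ = z≤n

-- Two points of `P` in a window of length at most `n` would differ by a positive multiple of `n`
-- that is below `n`.
count-block : ∀ {P : ℕ → Set} (P? : Decidable P) n s →
  (∀ {i j} → P i → P j → i ≤ j → n ∣ j ∸ i) →
  ∀ k → k ≤ n → ∑ (downFrom k) (λ i → 𝟙 (P? (i + s))) ≤ 1
count-block P? n s sep zero    k≤n = z≤n
count-block P? n s sep (suc k) k<n with P? (k + s)
... | no  _   = count-block P? n s sep k (<⇒≤ k<n)
... | yes Pks = ≤-reflexive (cong suc (n≤0⇒n≡0 (≤-trans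
        (∑-mono-∈ (downFrom k) (λ i∈ → ≤-reflexive (𝟙-no (P? _) (none (∈-downFrom⁻ i∈)))))
        (≤-reflexive (∑-zero (downFrom k))))))
  where
  none : ∀ {i} → i < k → ¬ _
  none {i} i<k Pis = <⇒≱ (≤-<-trans (m∸n≤m k i) k<n) (∣⇒≤ {{>-nonZero (m<n⇒0<n∸m i<k)}}
    (subst (n ∣_) ([m+n]∸[o+n] k i s) (sep Pis Pks (+-monoˡ-≤ s (<⇒≤ i<k)))))
    where
    [m+n]∸[o+n] : ∀ k i s → (k + s) ∸ (i + s) ≡ k ∸ i
    [m+n]∸[o+n] k i s = trans (cong₂ _∸_ (+-comm k s) (+-comm i s)) ([m+n]∸[m+o]≡n∸o s k i)

count-separated : ∀ {P : ℕ → Set} (P? : Decidable P) n →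
  (∀ {i j} → P i → P j → i ≤ j → n ∣ j ∸ i) →
  ∀ k → ∑ (downFrom (k * n)) (𝟙 ∘ P?) ≤ k
count-separated P? n sep zero    = z≤n
count-separated P? n sep (suc k) = ≤-trans
  (≤-reflexive (∑-downFrom-+ n (k * n) (𝟙 ∘ P?)))
  (+-mono-≤ (count-block P? n (k * n) sep n ≤-refl) (count-separated P? n sep k))

-- Residue classes

-- The absolute value matches the divisibility of integers that `Covers` is stated with.
χ : ℕ → ℤ → ℕ → ℕ
χ m a x = 𝟙 (m ∣? ℤ.∣ pos x ℤ.- a ∣)

χ≤1 : ∀ m a x → χ m a x ≤ 1
χ≤1 m a x = 𝟙≤1 (m ∣? _)

χ-mono : ∀ {m m′} → m ∣ m′ → ∀ a x → χ m′ a x ≤ χ m a x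
χ-mono m∣m′ a x = 𝟙-mono (_ ∣? _) (_ ∣? _) (∣-trans m∣m′)

pos-shift : ∀ x w a → pos (x + w) ℤ.- a ≡ (pos x ℤ.- a) ℤ.+ pos w
pos-shift x w a = trans (cong (ℤ._- a) (ℤ.pos-+ x w)) (regroup (pos x) a (pos w))
  where
  regroup : ∀ (y a z : ℤ) → (y ℤ.+ z) ℤ.- a ≡ (y ℤ.- a) ℤ.+ z
  regroup = ℤ.solve-∀

∣-shift : ∀ {m Q} → m ∣ Q → ∀ a y t → m ∣ ℤ.∣ pos (y + Q * t) ℤ.- a ∣ → m ∣ ℤ.∣ pos y ℤ.- a ∣
∣-shift {m} {Q} m∣Q a y t h = ℤ.∣⇒∣ᵤ (ℤ.∣m+n∣n⇒∣m {pos m} {pos y ℤ.- a} {pos (Q * t)}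
  (subst (pos m ℤ.∣_) (pos-shift y (Q * t) a) (ℤ.∣ᵤ⇒∣ h))
  (ℤ.∣ᵤ⇒∣ (∣-trans m∣Q (m∣m*n t))))

χ-shift : ∀ {m Q} → m ∣ Q → ∀ a y t → χ m a (y + Q * t) ≤ χ m a y
χ-shift m∣Q a y t = 𝟙-mono (_ ∣? _) (_ ∣? _) (∣-shift m∣Q a y t)

-- Induction on `e`: Euclid's lemma finds a factor `p` in `z`, and one `p` is cancelled on both
-- sides.
prime^∣*⇒∣ : ∀ {p Q} → Prime p → ¬ p ∣ Q → ∀ e z → p ^ e ∣ Q * z → p ^ e ∣ z
prime^∣*⇒∣ pp p∤Q zero z _ = 1∣ z
prime^∣*⇒∣ {p} {Q} pp p∤Q (suc e) z h with euclidsLemma Q z pp (∣-trans (m∣m*n (p ^ e)) h)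
... | inj₁ p∣Q = contradiction p∣Q p∤Q
... | inj₂ (divides w refl) = subst (_∣ w * p) (*-comm (p ^ e) p)
  (*-monoˡ-∣ p (prime^∣*⇒∣ pp p∤Q e w
    (*-cancelˡ-∣ p {{prime⇒nonZero pp}} (subst (p * p ^ e ∣_) (rearr Q w p) h))))
  where
  rearr : ∀ Q w p → Q * (w * p) ≡ p * (Q * w)
  rearr = solve-∀

-- `Q` is invertible modulo `p ^ e`, so the congruence on `y + Q * t` pins down `t` modulo `p ^ e`.
χ-equidistributed : ∀ {p Q} → Prime p → ¬ p ∣ Q → ∀ G e a y →
  ∑ (downFrom (p ^ G)) (λ t → χ (p ^ e) a (y + Q * t)) ≤ p ^ (G ∸ e)
χ-equidistributed {p} {Q} pp p∤Q G e a y = begin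
  ∑ (downFrom (p ^ G)) (λ t → χ (p ^ e) a (y + Q * t))
    ≤⟨ ∑-downFrom-mono-range _ range ⟩
  ∑ (downFrom (p ^ (G ∸ e) * p ^ e)) (λ t → χ (p ^ e) a (y + Q * t))
    ≤⟨ count-separated (λ t → p ^ e ∣? ℤ.∣ pos (y + Q * t) ℤ.- a ∣) (p ^ e) (λ {i} {j} → separated i j) (p ^ (G ∸ e)) ⟩
  p ^ (G ∸ e) ∎
  where
  open ≤-Reasoning
  -- An equality for `e ≤ G`; for larger `e`, where `G ∸ e` is 0, the range of `t` is lengthened to
  -- `p ^ e`.
  range : p ^ G ≤ p ^ (G ∸ e) * p ^ e
  range = ≤-trans (^-monoʳ-≤ p {{prime⇒nonZero pp}} (m≤n+m∸n G e))
    (≤-reflexive (trans (cong (p ^_) (+-comm e (G ∸ e))) (^-distribˡ-+-* p (G ∸ e) e)))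
  separated : ∀ i j → p ^ e ∣ ℤ.∣ pos (y + Q * i) ℤ.- a ∣ → p ^ e ∣ ℤ.∣ pos (y + Q * j) ℤ.- a ∣ →
    i ≤ j → p ^ e ∣ j ∸ i
  separated i j hi hj i≤j = prime^∣*⇒∣ pp p∤Q e (j ∸ i)
    (ℤ.∣⇒∣ᵤ (ℤ.∣m+n∣m⇒∣n {pos (p ^ e)} {pos (y + Q * i) ℤ.- a} {pos (Q * (j ∸ i))}
      (subst (pos (p ^ e) ℤ.∣_)
        (trans (cong (λ x → pos x ℤ.- a) split) (pos-shift (y + Q * i) (Q * (j ∸ i)) a)) (ℤ.∣ᵤ⇒∣ hj))
      (ℤ.∣ᵤ⇒∣ hi)))
    where
    split : y + Q * j ≡ y + Q * i + Q * (j ∸ i)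
    split = trans (cong (λ k → y + Q * k) (sym (m+[n∸m]≡n i≤j)))
      (trans (cong (y +_) (*-distribˡ-+ Q i (j ∸ i))) (sym (+-assoc y (Q * i) _)))

-- Weighted measures on ℕ

Measure : Set
Measure = List (ℕ × ℕ)

E : Measure → (ℕ → ℕ) → ℕ
E μ f = ∑ μ (λ (w , x) → w * f x)

E-mono : ∀ μ {f g} → (∀ x → f x ≤ g x) → E μ f ≤ E μ g
E-mono μ h = ∑-mono μ (λ (w , x) → *-monoʳ-≤ w (h x))

E-+ : ∀ μ f g → E μ (λ x → f x + g x) ≡ E μ f + E μ g
E-+ μ f g = trans (∑-cong μ (λ (w , x) → *-distribˡ-+ w (f x) (g x))) (∑-+ μ _ _)

E-*ˡ : ∀ μ c f → E μ (λ x → c * f x) ≡ c * E μ f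
E-*ˡ μ c f = trans (∑-cong μ (λ (w , x) → *-swap w c (f x))) (∑-*ˡ μ c _)

E-∑ : ∀ μ (xs : List A) (f : A → ℕ → ℕ) → E μ (λ x → ∑ xs (λ i → f i x)) ≡ ∑ xs (λ i → E μ (f i))
E-∑ μ xs f = trans (∑-cong μ (λ (w , x) → sym (∑-*ˡ xs w (λ i → f i x)))) (∑-swap μ xs _)

reweigh : (ℕ → ℕ) → Measure → Measure
reweigh g = map (λ (w , x) → (w * g x , x))

E-reweigh : ∀ g μ f → E (reweigh g μ) f ≡ E μ (λ x → g x * f x)
E-reweigh g μ f = trans (∑-map _ μ _) (∑-cong μ (λ (w , x) → *-assoc w (g x) (f x)))

-- Lifts residues modulo `Q` to residues modulo `Q * q`; `k y` is the density on the fibre over `y`.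
spread : ℕ → ℕ → (ℕ → ℕ → ℕ) → Measure → Measure
spread Q q k = concatMap (λ (w , y) → map (λ t → (w * k y t , y + Q * t)) (downFrom q))

E-spread : ∀ Q q k μ f →
  E (spread Q q k μ) f ≡ E μ (λ y → ∑ (downFrom q) (λ t → k y t * f (y + Q * t)))
E-spread Q q k μ f = trans (∑-concatMap _ μ _) (∑-cong μ (λ (w , y) →
  trans (∑-map _ (downFrom q) _) (trans
    (∑-cong (downFrom q) (λ t → *-assoc w (k y t) (f (y + Q * t))))
    (∑-*ˡ (downFrom q) w _))))

-- Geometric sums

-- The factorisation of a difference of powers of `c + b` and `b`, free of subtraction.
geometric : ∀ c b n →
  c * ∑ (downFrom (suc n)) (λ e → (c + b) ^ (n ∸ e) * b ^ e) + b ^ suc n ≡ (c + b) ^ suc n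
geometric c b zero    = base c b
  where
  base : ∀ c b → c * (1 * 1 + 0) + b * 1 ≡ (c + b) * 1
  base = solve-∀
geometric c b (suc n) = begin
  c * ∑ (downFrom (suc (suc n))) (λ e → (c + b) ^ (suc n ∸ e) * b ^ e) + b ^ suc (suc n)
    ≡⟨ cong (λ z → c * z + b ^ suc (suc n)) (∑-downFrom-last (suc n) (λ e → (c + b) ^ (suc n ∸ e) * b ^ e)) ⟩
  c * (∑ (downFrom (suc n)) (λ e → (c + b) ^ (n ∸ e) * (b * b ^ e)) + (c + b) ^ suc n * 1) + b ^ suc (suc n)
    ≡⟨ cong (λ z → c * (z + (c + b) ^ suc n * 1) + b ^ suc (suc n))
         (trans (∑-cong (downFrom (suc n)) (λ e → *-swap ((c + b) ^ (n ∸ e)) b (b ^ e))) (∑-*ˡ (downFrom (suc n)) b _)) ⟩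
  c * (b * Z + (c + b) ^ suc n * 1) + b * b ^ suc n
    ≡⟨ rearr c b Z ((c + b) ^ suc n) (b ^ suc n) ⟩
  b * (c * Z + b ^ suc n) + c * (c + b) ^ suc n
    ≡⟨ cong (λ z → b * z + c * (c + b) ^ suc n) (geometric c b n) ⟩
  b * (c + b) ^ suc n + c * (c + b) ^ suc n
    ≡⟨ collect b c ((c + b) ^ suc n) ⟩
  (c + b) * (c + b) ^ suc n ∎
  where
  open ≡-Reasoning
  Z = ∑ (downFrom (suc n)) (λ e → (c + b) ^ (n ∸ e) * b ^ e)
  rearr : ∀ c b Z a d → c * (b * Z + a * 1) + b * d ≡ b * (c * Z + d) + c * a
  rearr = solve-∀
  collect : ∀ b c a → b * a + c * a ≡ (c + b) * a
  collect = solve-∀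

-- In normalised form, the sum of p^(-e) over 1 ≤ e ≤ n is below 1 / (p - 1), where p is `suc v`.
geometric-1 : ∀ v n → v * ∑ (downFrom n) (λ e → suc v ^ (n ∸ suc e)) + 1 ≡ suc v ^ n
geometric-1 v zero    = cong (_+ 1) (*-zeroʳ v)
geometric-1 v (suc n) = begin
  v * ∑ (downFrom (suc n)) (λ e → suc v ^ (n ∸ e)) + 1
    ≡⟨ cong (λ z → v * z + 1) (∑-downFrom-last n _) ⟩
  v * (∑ (downFrom n) (λ e → suc v ^ (n ∸ suc e)) + suc v ^ n) + 1
    ≡⟨ rearr v (∑ (downFrom n) (λ e → suc v ^ (n ∸ suc e))) (suc v ^ n) ⟩
  v * suc v ^ n + (v * ∑ (downFrom n) (λ e → suc v ^ (n ∸ suc e)) + 1)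
    ≡⟨ cong (v * suc v ^ n +_) (geometric-1 v n) ⟩
  v * suc v ^ n + suc v ^ n
    ≡⟨ +-comm (v * suc v ^ n) _ ⟩
  suc v ^ suc n ∎
  where
  open ≡-Reasoning
  rearr : ∀ v z a → v * (z + a) + 1 ≡ v * a + (v * z + 1)
  rearr = solve-∀

∑∑-downFrom-last : ∀ n (f : ℕ → ℕ → ℕ) →
  ∑ (downFrom (suc n)) (λ i → ∑ (downFrom (suc n)) (f i)) ≡
  ∑ (downFrom n) (λ i → ∑ (downFrom n) (λ j → f (suc i) (suc j)))
    + ∑ (downFrom n) (λ i → f (suc i) 0) + ∑ (downFrom n) (λ j → f 0 (suc j)) + f 0 0
∑∑-downFrom-last n f = begin
  ∑ (downFrom (suc n)) (λ i → ∑ (downFrom (suc n)) (f i))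
    ≡⟨ ∑-downFrom-last n _ ⟩
  ∑ (downFrom n) (λ i → ∑ (downFrom (suc n)) (f (suc i))) + ∑ (downFrom (suc n)) (f 0)
    ≡⟨ cong₂ _+_ (trans (∑-cong (downFrom n) (λ i → ∑-downFrom-last n (f (suc i)))) (∑-+ (downFrom n) _ _))
                 (∑-downFrom-last n (f 0)) ⟩
  (∑ (downFrom n) (λ i → ∑ (downFrom n) (λ j → f (suc i) (suc j))) + ∑ (downFrom n) (λ i → f (suc i) 0))
    + (∑ (downFrom n) (λ j → f 0 (suc j)) + f 0 0)
    ≡⟨ +-assoc (∑ (downFrom n) (λ i → ∑ (downFrom n) (λ j → f (suc i) (suc j))) + ∑ (downFrom n) (λ i → f (suc i) 0)) _ _ ⟨
  _ ∎
  where open ≡-Reasoning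

-- The sum of p^(-max(e, e′)) over all e, e′ ≥ 0 is p (p + 1) / (p - 1)², where p is `suc v`; the
-- added linear term accounts for the truncation at `n`. The induction splits off the row and the
-- column of exponent 0.
geometric-⊔ : ∀ v n →
  v * v * ∑ (downFrom (suc n)) (λ e → ∑ (downFrom (suc n)) (λ e′ → suc v ^ (n ∸ (e ⊔ e′))))
    + (2 * v * n + 3 * v + 2) ≡ suc v ^ n * (suc v * suc (suc v))
geometric-⊔ v zero    = base v
  where
  base : ∀ v → v * v * (1 + 0 + 0) + (2 * v * 0 + 3 * v + 2) ≡ 1 * (suc v * suc (suc v))
  base = solve-∀
geometric-⊔ v (suc n) = begin
  v * v * ∑ (downFrom (suc (suc n))) (λ e → ∑ (downFrom (suc (suc n))) (λ e′ → suc v ^ (suc n ∸ (e ⊔ e′)))) + (2 * v * suc n + 3 * v + 2)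
    ≡⟨ cong (λ z → v * v * z + (2 * v * suc n + 3 * v + 2)) (∑∑-downFrom-last (suc n) (λ e e′ → suc v ^ (suc n ∸ (e ⊔ e′)))) ⟩
  v * v * (W + g + g + suc v ^ suc n) + (2 * v * suc n + 3 * v + 2)
    ≡⟨ rearr v W g (suc v ^ suc n) n ⟩
  (v * v * W + (2 * v * n + 3 * v + 2)) + 2 * v * (v * g + 1) + v * v * suc v ^ suc n
    ≡⟨ cong₂ (λ a b → a + 2 * v * b + v * v * suc v ^ suc n) (geometric-⊔ v n) (geometric-1 v (suc n)) ⟩
  suc v ^ n * (suc v * suc (suc v)) + 2 * v * (suc v ^ suc n) + v * v * suc v ^ suc n
    ≡⟨ collect v (suc v ^ n) ⟩
  suc v ^ suc n * (suc v * suc (suc v)) ∎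
  where
  open ≡-Reasoning
  W = ∑ (downFrom (suc n)) (λ e → ∑ (downFrom (suc n)) (λ e′ → suc v ^ (n ∸ (e ⊔ e′))))
  g = ∑ (downFrom (suc n)) (λ e → suc v ^ (n ∸ e))
  rearr : ∀ v W g a n → v * v * (W + g + g + a) + (2 * v * suc n + 3 * v + 2)
    ≡ (v * v * W + (2 * v * n + 3 * v + 2)) + 2 * v * (v * g + 1) + v * v * a
  rearr = solve-∀
  collect : ∀ v a → a * (suc v * suc (suc v)) + 2 * v * (suc v * a) + v * v * (suc v * a)
    ≡ (suc v * a) * (suc v * suc (suc v))
  collect = solve-∀

-- Second moments on the fibres

∑-*-∑∑ : ∀ {C : Set} (zs : List C) (xs : List A) (ys : List B) (k : C → ℕ) (F : C → A → B → ℕ) →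
  ∑ zs (λ z → k z * ∑ xs (λ x → ∑ ys (λ y → F z x y))) ≡
  ∑ xs (λ x → ∑ ys (λ y → ∑ zs (λ z → k z * F z x y)))
∑-*-∑∑ zs xs ys k F = begin
  ∑ zs (λ z → k z * ∑ xs (λ x → ∑ ys (F z x)))
    ≡⟨ ∑-cong zs (λ z → trans (sym (∑-*ˡ xs (k z) _)) (∑-cong xs (λ x → sym (∑-*ˡ ys (k z) _)))) ⟩
  ∑ zs (λ z → ∑ xs (λ x → ∑ ys (λ y → k z * F z x y)))
    ≡⟨ ∑-swap zs xs _ ⟩
  ∑ xs (λ x → ∑ zs (λ z → ∑ ys (λ y → k z * F z x y)))
    ≡⟨ ∑-cong xs (λ x → ∑-swap zs ys _) ⟩
  ∑ xs (λ x → ∑ ys (λ y → ∑ zs (λ z → k z * F z x y))) ∎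
  where open ≡-Reasoning

S : List ℕ → (ℕ → ℤ) → ℕ → ℕ
S L r x = ∑ L (λ m → χ m (r m) x)

extend : ℕ → ℕ → List ℕ → List ℕ
extend p G L = cartesianProductWith (λ e m → m * p ^ e) (downFrom (suc G)) L

-- The part of `r` that concerns exponent `e` at `p`, read as residues for the cofactors `m`.
-- Induction hypotheses are applied to such twists and therefore quantify over all `r`.
twist : ℕ → ℕ → (ℕ → ℤ) → ℕ → ℤ
twist p e r m = r (m * p ^ e)

≤1⇒≤* : ∀ {c a b} → c ≤ 1 → c ≤ a → c ≤ b → c ≤ a * b
≤1⇒≤* {zero}      _ _ _ = z≤n
≤1⇒≤* {suc zero}  _ p q = *-mono-≤ p q
≤1⇒≤* {suc (suc _)} (s≤s ()) _ _

-- The congruence modulo `m * n` implies those modulo `m` and `n`; since `m ∣ Q`, the former depends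
-- on `y` alone.
χ-fibre : ∀ {m Q} → m ∣ Q → ∀ n a y t → χ (m * n) a (y + Q * t) ≤ χ m a y * χ n a (y + Q * t)
χ-fibre {m} m∣Q n a y t = ≤1⇒≤* (χ≤1 (m * n) a _)
  (≤-trans (χ-mono (m∣m*n n) a _) (χ-shift m∣Q a y t))
  (χ-mono (n∣m*n m) a _)

-- For `e = e′ = 0` there is no condition at `p`, and the mass `τ` of the fibre is the bound; the
-- supremum `κ` of the kernel affects only the other pairs.
pairBound : ℕ → ℕ → ℕ → ℕ → ℕ → ℕ → ℕ
pairBound p G κ τ zero zero = τ
pairBound p G κ τ e    e′   = κ * p ^ (G ∸ (e ⊔ e′))

χχ-equidistributed : ∀ {p Q} → Prime p → ¬ p ∣ Q → ∀ G e e′ a a′ y →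
  ∑ (downFrom (p ^ G)) (λ t → χ (p ^ e) a (y + Q * t) * χ (p ^ e′) a′ (y + Q * t)) ≤ p ^ (G ∸ (e ⊔ e′))
χχ-equidistributed {p} {Q} pp p∤Q G e e′ a a′ y with ⊔-sel e e′
... | inj₁ eq rewrite eq = ≤-trans
  (∑-mono (downFrom (p ^ G)) (λ t → ≤-trans (*-monoʳ-≤ (χ (p ^ e) a (y + Q * t)) (χ≤1 (p ^ e′) a′ (y + Q * t))) (≤-reflexive (*-identityʳ _))))
  (χ-equidistributed pp p∤Q G e a y)
... | inj₂ eq rewrite eq = ≤-trans
  (∑-mono (downFrom (p ^ G)) (λ t → ≤-trans (*-monoˡ-≤ (χ (p ^ e′) a′ (y + Q * t)) (χ≤1 (p ^ e) a (y + Q * t))) (≤-reflexive (*-identityˡ _))))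
  (χ-equidistributed pp p∤Q G e′ a′ y)

module Fibres {p Q : ℕ} (pp : Prime p) (p∤Q : ¬ p ∣ Q) (G : ℕ) {L : List ℕ}
  (L∣Q : ∀ {d} → d ∈ L → d ∣ Q) where

  q : ℕ
  q = p ^ G

  module Moments (k : ℕ → ℕ → ℕ) (κ τ : ℕ)
    (k≤κ : ∀ y t → k y t ≤ κ) (∑k≤τ : ∀ y → ∑ (downFrom q) (k y) ≤ τ) where

    b : ℕ → ℕ → ℕ
    b = pairBound p G κ τ

    b-off-diagonal : ∀ e e′ a a′ y →
      ∑ (downFrom q) (λ t → k y t * (χ (p ^ e) a (y + Q * t) * χ (p ^ e′) a′ (y + Q * t))) ≤ κ * p ^ (G ∸ (e ⊔ e′))
    b-off-diagonal e e′ a a′ y = begin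
      ∑ (downFrom q) (λ t → k y t * (χ (p ^ e) a (y + Q * t) * χ (p ^ e′) a′ (y + Q * t)))
        ≤⟨ ∑-mono (downFrom q) (λ t → *-monoˡ-≤ _ (k≤κ y t)) ⟩
      ∑ (downFrom q) (λ t → κ * (χ (p ^ e) a (y + Q * t) * χ (p ^ e′) a′ (y + Q * t)))
        ≡⟨ ∑-*ˡ (downFrom q) κ _ ⟩
      κ * ∑ (downFrom q) (λ t → χ (p ^ e) a (y + Q * t) * χ (p ^ e′) a′ (y + Q * t))
        ≤⟨ *-monoʳ-≤ κ (χχ-equidistributed pp p∤Q G e e′ a a′ y) ⟩
      κ * p ^ (G ∸ (e ⊔ e′)) ∎
      where open ≤-Reasoning

    ∑kχχ≤b : ∀ e e′ a a′ y →
      ∑ (downFrom q) (λ t → k y t * (χ (p ^ e) a (y + Q * t) * χ (p ^ e′) a′ (y + Q * t))) ≤ b e e′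
    ∑kχχ≤b zero zero a a′ y = ≤-trans
      (∑-mono (downFrom q) (λ t → ≤-trans
        (*-monoʳ-≤ (k y t) (*-mono-≤ (χ≤1 1 a _) (χ≤1 1 a′ _))) (≤-reflexive (*-identityʳ _))))
      (∑k≤τ y)
    ∑kχχ≤b zero    (suc e′) = b-off-diagonal zero (suc e′)
    ∑kχχ≤b (suc e) zero     = b-off-diagonal (suc e) zero
    ∑kχχ≤b (suc e) (suc e′) = b-off-diagonal (suc e) (suc e′)

    -- The conditions modulo the cofactors depend on `y` only and factor out; over `t` there remain
    -- two conditions modulo powers of `p`.
    fibre-layer : ∀ e e′ (r r′ : ℕ → ℤ) y →
      ∑ (downFrom q) (λ t → k y t *
        (∑ L (λ m → χ (m * p ^ e) (r m) (y + Q * t)) * ∑ L (λ m → χ (m * p ^ e′) (r′ m) (y + Q * t))))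
      ≤ b e e′ * (S L r y * S L r′ y)
    fibre-layer e e′ r r′ y = begin
      ∑ (downFrom q) (λ t → k y t *
        (∑ L (λ m → χ (m * p ^ e) (r m) (y + Q * t)) * ∑ L (λ m → χ (m * p ^ e′) (r′ m) (y + Q * t))))
        ≤⟨ ∑-mono (downFrom q) (λ t → *-monoʳ-≤ (k y t) (*-mono-≤
             (∑-mono-∈ L (λ {m} m∈L → χ-fibre (L∣Q m∈L) (p ^ e) (r m) y t))
             (∑-mono-∈ L (λ {m} m∈L → χ-fibre (L∣Q m∈L) (p ^ e′) (r′ m) y t)))) ⟩
      ∑ (downFrom q) (λ t → k y t * (∑ L (λ m → u m * v m t) * ∑ L (λ m → u′ m * v′ m t)))
        ≡⟨ ∑-cong (downFrom q) (λ t → cong (k y t *_) (∑-*-∑ L L _ _)) ⟩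
      ∑ (downFrom q) (λ t → k y t * ∑ L (λ m → ∑ L (λ m′ → (u m * v m t) * (u′ m′ * v′ m′ t))))
        ≡⟨ ∑-*-∑∑ (downFrom q) L L (k y) (λ t m m′ → (u m * v m t) * (u′ m′ * v′ m′ t)) ⟩
      ∑ L (λ m → ∑ L (λ m′ → ∑ (downFrom q) (λ t → k y t * ((u m * v m t) * (u′ m′ * v′ m′ t)))))
        ≡⟨ ∑-cong L (λ m → ∑-cong L (λ m′ → trans
             (∑-cong (downFrom q) (λ t → rearr (k y t) (u m) (v m t) (u′ m′) (v′ m′ t)))
             (∑-*ˡ (downFrom q) (u m * u′ m′) _))) ⟩
      ∑ L (λ m → ∑ L (λ m′ → (u m * u′ m′) * ∑ (downFrom q) (λ t → k y t * (v m t * v′ m′ t))))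
        ≤⟨ ∑-mono L (λ m → ∑-mono L (λ m′ → *-monoʳ-≤ (u m * u′ m′) (∑kχχ≤b e e′ (r m) (r′ m′) y))) ⟩
      ∑ L (λ m → ∑ L (λ m′ → (u m * u′ m′) * b e e′))
        ≡⟨ ∑-cong L (λ m → ∑-*ʳ L (b e e′) _) ⟩
      ∑ L (λ m → ∑ L (λ m′ → u m * u′ m′) * b e e′)
        ≡⟨ ∑-*ʳ L (b e e′) _ ⟩
      ∑ L (λ m → ∑ L (λ m′ → u m * u′ m′)) * b e e′
        ≡⟨ cong (_* b e e′) (sym (∑-*-∑ L L u u′)) ⟩
      (S L r y * S L r′ y) * b e e′
        ≡⟨ *-comm _ (b e e′) ⟩
      b e e′ * (S L r y * S L r′ y) ∎
      where
      open ≤-Reasoning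
      u u′ : ℕ → ℕ
      u m = χ m (r m) y
      u′ m = χ m (r′ m) y
      v v′ : ℕ → ℕ → ℕ
      v m t = χ (p ^ e) (r m) (y + Q * t)
      v′ m t = χ (p ^ e′) (r′ m) (y + Q * t)
      rearr : ∀ k u v u′ v′ → k * ((u * v) * (u′ * v′)) ≡ (u * u′) * (k * (v * v′))
      rearr = solve-∀

    fibre-moment : ∀ (r r′ : ℕ → ℤ) y →
      ∑ (downFrom q) (λ t → k y t * (S (extend p G L) r (y + Q * t) * S (extend p G L) r′ (y + Q * t)))
      ≤ ∑ (downFrom (suc G)) (λ e → ∑ (downFrom (suc G)) (λ e′ →
          b e e′ * (S L (twist p e r) y * S L (twist p e′ r′) y)))
    fibre-moment r r′ y = begin
      ∑ (downFrom q) (λ t → k y t * (S (extend p G L) r (y + Q * t) * S (extend p G L) r′ (y + Q * t)))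
        ≡⟨ ∑-cong (downFrom q) (λ t → cong (k y t *_) (trans
             (cong₂ _*_ (layers r (y + Q * t)) (layers r′ (y + Q * t)))
             (∑-*-∑ (downFrom (suc G)) (downFrom (suc G)) (λ e → layer r e (y + Q * t)) (λ e → layer r′ e (y + Q * t))))) ⟩
      ∑ (downFrom q) (λ t → k y t * ∑ (downFrom (suc G)) (λ e → ∑ (downFrom (suc G)) (λ e′ →
          layer r e (y + Q * t) * layer r′ e′ (y + Q * t))))
        ≡⟨ ∑-*-∑∑ (downFrom q) (downFrom (suc G)) (downFrom (suc G)) (k y)
             (λ t e e′ → layer r e (y + Q * t) * layer r′ e′ (y + Q * t)) ⟩
      ∑ (downFrom (suc G)) (λ e → ∑ (downFrom (suc G)) (λ e′ →
        ∑ (downFrom q) (λ t → k y t * (layer r e (y + Q * t) * layer r′ e′ (y + Q * t)))))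
        ≤⟨ ∑-mono (downFrom (suc G)) (λ e → ∑-mono (downFrom (suc G)) (λ e′ →
             fibre-layer e e′ (twist p e r) (twist p e′ r′) y)) ⟩
      ∑ (downFrom (suc G)) (λ e → ∑ (downFrom (suc G)) (λ e′ →
          b e e′ * (S L (twist p e r) y * S L (twist p e′ r′) y))) ∎
      where
      open ≤-Reasoning
      layer : (ℕ → ℤ) → ℕ → ℕ → ℕ
      layer r e x = ∑ L (λ m → χ (m * p ^ e) (twist p e r m) x)
      layers : ∀ r x → S (extend p G L) r x ≡ ∑ (downFrom (suc G)) (λ e → layer r e x)
      layers r x = ∑-cartesianProductWith _ (downFrom (suc G)) L _

    ∑b : ℕ
    ∑b = ∑ (downFrom (suc G)) (λ e → ∑ (downFrom (suc G)) (b e))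

    -- Each pair of exponents uses the hypothesis for its own pair of twists, so the bound is
    -- multiplied by the sum of all `b e e′`.
    moment-step : ∀ {μ C K N} →
      (∀ r r′ → K * E μ (λ x → S L r x * S L r′ x) ≤ C * N) →
      ∀ r r′ → K * E (spread Q q k μ) (λ x → S (extend p G L) r x * S (extend p G L) r′ x) ≤ ∑b * (C * N)
    moment-step {μ} {C} {K} {N} hyp r r′ = begin
      K * E (spread Q q k μ) (λ x → S (extend p G L) r x * S (extend p G L) r′ x)
        ≡⟨ cong (K *_) (E-spread Q q k μ _) ⟩
      K * E μ (λ y → ∑ (downFrom q) (λ t → k y t * (S (extend p G L) r (y + Q * t) * S (extend p G L) r′ (y + Q * t))))
        ≤⟨ *-monoʳ-≤ K (E-mono μ (fibre-moment r r′)) ⟩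
      K * E μ (λ y → ∑ Es (λ e → ∑ Es (λ e′ → b e e′ * F e e′ y)))
        ≡⟨ cong (K *_) (trans (E-∑ μ Es _) (∑-cong Es (λ e → trans (E-∑ μ Es _) (∑-cong Es (λ e′ → E-*ˡ μ (b e e′) _))))) ⟩
      K * ∑ Es (λ e → ∑ Es (λ e′ → b e e′ * E μ (F e e′)))
        ≡⟨ sym (trans (∑-cong Es (λ e → ∑-*ˡ Es K _)) (∑-*ˡ Es K _)) ⟩
      ∑ Es (λ e → ∑ Es (λ e′ → K * (b e e′ * E μ (F e e′))))
        ≤⟨ ∑-mono Es (λ e → ∑-mono Es (λ e′ → ≤-trans (≤-reflexive (*-swap K (b e e′) _))
             (*-monoʳ-≤ (b e e′) (hyp (twist p e r) (twist p e′ r′))))) ⟩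
      ∑ Es (λ e → ∑ Es (λ e′ → b e e′ * (C * N)))
        ≡⟨ trans (∑-cong Es (λ e → ∑-*ʳ Es (C * N) (b e))) (∑-*ʳ Es (C * N) (λ e → ∑ Es (b e))) ⟩
      ∑b * (C * N) ∎
      where
      open ≤-Reasoning
      Es = downFrom (suc G)
      F : ℕ → ℕ → ℕ → ℕ
      F e e′ y = S L (twist p e r) y * S L (twist p e′ r′) y

-- Replacing the term `τ` at (0, 0) by `κ * p ^ G` makes `geometric-⊔` applicable, and p (p + 1) -
-- (p - 1)² = 3 p - 1, which is `3 * v + 2`.
∑-pairBound : ∀ v G κ τ →
  v * v * ∑ (downFrom (suc G)) (λ e → ∑ (downFrom (suc G)) (pairBound (suc v) G κ τ e))
  ≤ v * v * τ + κ * suc v ^ G * (3 * v + 2)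
∑-pairBound v G κ τ = +-cancelʳ-≤ (v * v * (κ * q)) _ _ (begin
  v * v * ∑ Es (λ e → ∑ Es (pairBound (suc v) G κ τ e)) + v * v * (κ * q)
    ≡⟨ cong (λ z → v * v * z + v * v * (κ * q)) (∑∑-downFrom-last G (pairBound (suc v) G κ τ)) ⟩
  v * v * (X + τ) + v * v * (κ * q)
    ≡⟨ exchange (v * v) X τ (κ * q) ⟩
  v * v * τ + v * v * (X + κ * q)
    ≡⟨ cong (λ z → v * v * τ + v * v * z) (sym (∑∑-downFrom-last G (λ e e′ → κ * suc v ^ (G ∸ (e ⊔ e′))))) ⟩
  v * v * τ + v * v * ∑ Es (λ e → ∑ Es (λ e′ → κ * suc v ^ (G ∸ (e ⊔ e′))))
    ≡⟨ cong (λ z → v * v * τ + v * v * z) (trans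
         (∑-cong Es (λ e → ∑-*ˡ Es κ (λ e′ → suc v ^ (G ∸ (e ⊔ e′)))))
         (∑-*ˡ Es κ (λ e → ∑ Es (λ e′ → suc v ^ (G ∸ (e ⊔ e′)))))) ⟩
  v * v * τ + v * v * (κ * W)
    ≡⟨ cong (v * v * τ +_) (*-swap (v * v) κ W) ⟩
  v * v * τ + κ * (v * v * W)
    ≤⟨ +-monoʳ-≤ (v * v * τ) (*-monoʳ-≤ κ (≤-trans (m≤m+n _ _) (≤-reflexive (geometric-⊔ v G)))) ⟩
  v * v * τ + κ * (q * (suc v * suc (suc v)))
    ≡⟨ expand v κ τ q ⟩
  v * v * τ + κ * q * (3 * v + 2) + v * v * (κ * q) ∎)
  where
  open ≤-Reasoning
  Es = downFrom (suc G)
  q = suc v ^ G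
  W = ∑ Es (λ e → ∑ Es (λ e′ → suc v ^ (G ∸ (e ⊔ e′))))
  X = ∑ (downFrom G) (λ i → ∑ (downFrom G) (λ j → κ * suc v ^ (G ∸ suc (i ⊔ j))))
    + ∑ (downFrom G) (λ i → κ * suc v ^ (G ∸ suc i)) + ∑ (downFrom G) (λ j → κ * suc v ^ (G ∸ suc j))
  exchange : ∀ u X τ z → u * (X + τ) + u * z ≡ u * τ + u * (X + z)
  exchange = solve-∀
  expand : ∀ v κ τ q → v * v * τ + κ * (q * (suc v * suc (suc v)))
    ≡ v * v * τ + κ * q * (3 * v + 2) + v * v * (κ * q)
  expand = solve-∀

-- Rankin's trick

^-distribʳ-* : ∀ m n k → (m * n) ^ k ≡ m ^ k * n ^ k
^-distribʳ-* m n zero    = refl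
^-distribʳ-* m n (suc k) = trans (cong (m * n *_) (^-distribʳ-* m n k)) ([m*n]*[o*p]≡[m*o]*[n*p] m n _ _)

cube : ℕ → ℕ
cube x = x * x * x

cube-* : ∀ x y → cube (x * y) ≡ cube x * cube y
cube-* = expand
  where
  expand : ∀ x y → x * y * (x * y) * (x * y) ≡ x * x * x * (y * y * y)
  expand = solve-∀

cube-^-mono : ∀ {p d b} → p * cube d ≤ cube b → ∀ e → p ^ e * cube (d ^ e) ≤ cube (b ^ e)
cube-^-mono h zero = ≤-refl
cube-^-mono {p} {d} {b} h (suc e) = begin
  p * p ^ e * cube (d * d ^ e)             ≡⟨ cong (p * p ^ e *_) (cube-* d (d ^ e)) ⟩
  p * p ^ e * (cube d * cube (d ^ e))      ≡⟨ [m*n]*[o*p]≡[m*o]*[n*p] p (p ^ e) (cube d) (cube (d ^ e)) ⟩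
  p * cube d * (p ^ e * cube (d ^ e))      ≤⟨ *-mono-≤ h (cube-^-mono {p} {d} {b} h e) ⟩
  cube b * cube (b ^ e)                    ≡⟨ cube-* b (b ^ e) ⟨
  cube (b * b ^ e)                         ∎
  where open ≤-Reasoning

-- In normalised terms, ∑ { P[x ≡ r d mod d] : d ∈ L, d ≥ z³ } ≤ (H / J) / z for every
-- positive rational z = y / s.
Rankin : Measure → List ℕ → ℕ → ℕ → ℕ → Set
Rankin μ L N H J = ∀ (r : ℕ → ℤ) s y →
  J * y * ∑ L (λ d → 𝟙 (cube y ≤? d * cube s) * E μ (χ d (r d))) ≤ H * N * s

-- There are two residue systems because expanding a square over the exponents of `p` pairs
-- different twists of one system.
Moment : Measure → List ℕ → ℕ → ℕ → ℕ → Set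
Moment μ L N C K = ∀ (r r′ : ℕ → ℤ) → K * E μ (λ x → S L r x * S L r′ x) ≤ C * N

module Steps {v Q : ℕ} (pp : Prime (suc v)) (p∤Q : ¬ suc v ∣ Q) (G : ℕ) {L : List ℕ}
  (L∣Q : ∀ {d} → d ∈ L → d ∣ Q) where

  open Fibres pp p∤Q G L∣Q public

  p : ℕ
  p = suc v

  -- In normalised form, `C / K` is multiplied by 1 + (c₁ / c₂) (3 p - 1) / (p - 1)². The uniform
  -- kernel has c₁ = c₂, the distorted one c₁ / c₂ = 6/5.
  moment-step′ : ∀ (k : ℕ → ℕ → ℕ) c₁ c₂ s →
    (∀ y t → k y t ≤ c₁ * s) → (∀ y → ∑ (downFrom q) (k y) ≤ c₂ * s * q) →
    ∀ {μ C K N} → Moment μ L N C K →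
    Moment (spread Q q k μ) (extend p G L) (N * (c₂ * s * q)) (C * (c₂ * (v * v) + c₁ * (3 * v + 2))) (K * (c₂ * (v * v)))
  moment-step′ k c₁ c₂ s k≤ ∑k≤ {μ} {C} {K} {N} hyp r r′ = begin
    K * (c₂ * (v * v)) * X                    ≡⟨ r₁ K c₂ (v * v) X ⟩
    c₂ * (v * v) * (K * X)                    ≤⟨ *-monoʳ-≤ (c₂ * (v * v)) (moment-step {μ} {C} {K} {N} hyp r r′) ⟩
    c₂ * (v * v) * (∑b * (C * N))             ≡⟨ r₂ c₂ (v * v) ∑b (C * N) ⟩
    c₂ * (C * N) * (v * v * ∑b)               ≤⟨ *-monoʳ-≤ (c₂ * (C * N)) (∑-pairBound v G (c₁ * s) (c₂ * s * q)) ⟩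
    c₂ * (C * N) * (v * v * (c₂ * s * q) + c₁ * s * q * (3 * v + 2)) ≡⟨ r₃ c₁ c₂ C N v s q ⟩
    C * (c₂ * (v * v) + c₁ * (3 * v + 2)) * (N * (c₂ * s * q)) ∎
    where
    open ≤-Reasoning
    open Moments k (c₁ * s) (c₂ * s * q) k≤ ∑k≤
    X = E (spread Q q k μ) (λ x → S (extend p G L) r x * S (extend p G L) r′ x)
    r₁ : ∀ K c u X → K * (c * u) * X ≡ c * u * (K * X)
    r₁ = solve-∀
    r₂ : ∀ c u b X → c * u * (b * X) ≡ c * X * (u * b)
    r₂ = solve-∀
    r₃ : ∀ c₁ c₂ C N v s q → c₂ * (C * N) * (v * v * (c₂ * s * q) + c₁ * s * q * (3 * v + 2))
      ≡ C * (c₂ * (v * v) + c₁ * (3 * v + 2)) * (N * (c₂ * s * q))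
    r₃ = solve-∀

  ∑χ-fibre : ∀ {m} → m ∈ L → ∀ e a y →
    ∑ (downFrom q) (λ t → χ (m * p ^ e) a (y + Q * t)) ≤ p ^ (G ∸ e) * χ m a y
  ∑χ-fibre {m} m∈L e a y = begin
    ∑ (downFrom q) (λ t → χ (m * p ^ e) a (y + Q * t))            ≤⟨ ∑-mono (downFrom q) (χ-fibre (L∣Q m∈L) (p ^ e) a y) ⟩
    ∑ (downFrom q) (λ t → χ m a y * χ (p ^ e) a (y + Q * t))      ≡⟨ ∑-*ˡ (downFrom q) (χ m a y) _ ⟩
    χ m a y * ∑ (downFrom q) (λ t → χ (p ^ e) a (y + Q * t))      ≤⟨ *-monoʳ-≤ (χ m a y) (χ-equidistributed pp p∤Q G e a y) ⟩
    χ m a y * p ^ (G ∸ e)                                         ≡⟨ *-comm (χ m a y) _ ⟩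
    p ^ (G ∸ e) * χ m a y                                         ∎
    where open ≤-Reasoning

  uniform : ℕ → ℕ → ℕ
  uniform _ _ = 1

  E-uniform-χ : ∀ μ {m} → m ∈ L → ∀ e a → E (spread Q q uniform μ) (χ (m * p ^ e) a) ≤ p ^ (G ∸ e) * E μ (χ m a)
  E-uniform-χ μ {m} m∈L e a = begin
    E (spread Q q uniform μ) (χ (m * p ^ e) a)                             ≡⟨ E-spread Q q uniform μ _ ⟩
    E μ (λ y → ∑ (downFrom q) (λ t → 1 * χ (m * p ^ e) a (y + Q * t)))     ≤⟨ E-mono μ (λ y → ≤-trans (≤-reflexive (∑-cong (downFrom q) (λ t → *-identityˡ _))) (∑χ-fibre m∈L e a y)) ⟩
    E μ (λ y → p ^ (G ∸ e) * χ m a y)                                      ≡⟨ E-*ˡ μ (p ^ (G ∸ e)) _ ⟩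
    p ^ (G ∸ e) * E μ (χ m a)                                              ∎
    where open ≤-Reasoning

  rankin-step : ∀ {μ N H J} D .{{_ : NonZero D}} b g → p * cube D ≤ cube b → g + b ≡ D * p →
    Rankin μ L N H J → Rankin (spread Q q uniform μ) (extend p G L) (N * q) (H * (D * p)) (J * g)
  rankin-step {μ} {N} {H} {J} D b g root g+b hyp r s y =
    -- The factor `D ^ G` clears the denominators `D ^ e` of the layers.
    *-cancelˡ-≤ (D ^ G) {{m^n≢0 D G}} (begin
      D ^ G * (J * g * y * ∑ (extend p G L) (λ d → 𝟙 (cube y ≤? d * cube s) * E μ′ (χ d (r d))))
        ≤⟨ *-monoʳ-≤ (D ^ G) (*-monoʳ-≤ (J * g * y) layers) ⟩
      D ^ G * (J * g * y * ∑ Es (λ e → p ^ (G ∸ e) * X e))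
        ≡⟨ r₁ (D ^ G) J g y _ ⟩
      g * (D ^ G * (J * y) * ∑ Es (λ e → p ^ (G ∸ e) * X e))
        ≡⟨ cong (g *_) (sym (∑-*ˡ Es (D ^ G * (J * y)) (λ e → p ^ (G ∸ e) * X e))) ⟩
      g * ∑ Es (λ e → D ^ G * (J * y) * (p ^ (G ∸ e) * X e))
        ≤⟨ *-monoʳ-≤ g (∑-mono Es layer-bound) ⟩
      g * ∑ Es (λ e → H * N * s * ((g + b) ^ (G ∸ e) * b ^ e))
        ≡⟨ cong (g *_) (∑-*ˡ Es (H * N * s) (λ e → (g + b) ^ (G ∸ e) * b ^ e)) ⟩
      g * (H * N * s * ∑ Es (λ e → (g + b) ^ (G ∸ e) * b ^ e))
        ≡⟨ *-swap g (H * N * s) _ ⟩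
      H * N * s * (g * ∑ Es (λ e → (g + b) ^ (G ∸ e) * b ^ e))
        ≤⟨ *-monoʳ-≤ (H * N * s) (≤-trans (m≤m+n _ _) (≤-reflexive (geometric g b G))) ⟩
      H * N * s * (g + b) ^ suc G
        ≡⟨ cong (λ z → H * N * s * z ^ suc G) g+b ⟩
      H * N * s * (D * p * (D * p) ^ G)
        ≡⟨ cong (λ z → H * N * s * (D * p * z)) (^-distribʳ-* D p G) ⟩
      H * N * s * (D * p * (D ^ G * q))
        ≡⟨ r₂ H N s (D * p) (D ^ G) q ⟩
      D ^ G * (H * (D * p) * (N * q) * s) ∎)
    where
    open ≤-Reasoning
    μ′ = spread Q q uniform μ
    Es = downFrom (suc G)
    X : ℕ → ℕ
    X e = ∑ L (λ m → 𝟙 (cube (y * D ^ e) ≤? m * cube (s * b ^ e)) * E μ (χ m (twist p e r m)))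
    r₁ : ∀ d J g y z → d * (J * g * y * z) ≡ g * (d * (J * y) * z)
    r₁ = solve-∀
    r₂ : ∀ H N s a d q → H * N * s * (a * (d * q)) ≡ d * (H * a * (N * q) * s)
    r₂ = solve-∀
    r₃ : ∀ m z w v → m * z * w * v ≡ m * w * (z * v)
    r₃ = solve-∀
    threshold : ∀ e m → cube y ≤ m * p ^ e * cube s → cube (y * D ^ e) ≤ m * cube (s * b ^ e)
    threshold e m h = begin
      cube (y * D ^ e)                          ≡⟨ cube-* y (D ^ e) ⟩
      cube y * cube (D ^ e)                     ≤⟨ *-monoˡ-≤ (cube (D ^ e)) h ⟩
      m * p ^ e * cube s * cube (D ^ e)         ≡⟨ r₃ m (p ^ e) (cube s) (cube (D ^ e)) ⟩
      m * cube s * (p ^ e * cube (D ^ e))       ≤⟨ *-monoʳ-≤ (m * cube s) (cube-^-mono {p} {D} {b} root e) ⟩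
      m * cube s * cube (b ^ e)                 ≡⟨ trans (*-assoc m _ _) (cong (m *_) (sym (cube-* s (b ^ e)))) ⟩
      m * cube (s * b ^ e)                      ∎
    layers : ∑ (extend p G L) (λ d → 𝟙 (cube y ≤? d * cube s) * E μ′ (χ d (r d))) ≤ ∑ Es (λ e → p ^ (G ∸ e) * X e)
    layers = begin
      ∑ (extend p G L) (λ d → 𝟙 (cube y ≤? d * cube s) * E μ′ (χ d (r d)))
        ≡⟨ ∑-cartesianProductWith _ Es L _ ⟩
      ∑ Es (λ e → ∑ L (λ m → 𝟙 (cube y ≤? m * p ^ e * cube s) * E μ′ (χ (m * p ^ e) (twist p e r m))))
        ≤⟨ ∑-mono Es (λ e → ≤-trans
             (∑-mono-∈ L (λ {m} m∈L → ≤-trans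
               (*-mono-≤ (𝟙-mono (_ ≤? _) (_ ≤? _) (threshold e m)) (E-uniform-χ μ m∈L e (twist p e r m)))
               (≤-reflexive (*-swap (𝟙 (cube (y * D ^ e) ≤? m * cube (s * b ^ e))) (p ^ (G ∸ e)) _))))
             (≤-reflexive (∑-*ˡ L (p ^ (G ∸ e)) _))) ⟩
      ∑ Es (λ e → p ^ (G ∸ e) * X e) ∎
    r₄ : ∀ a b j y p x → a * b * (j * y) * (p * x) ≡ a * p * (j * (y * b) * x)
    r₄ = solve-∀
    r₅ : ∀ z a s b → z * (a * (s * b)) ≡ a * s * (z * b)
    r₅ = solve-∀
    D-split : ∀ e → D ^ G ≤ D ^ (G ∸ e) * D ^ e
    D-split e = ≤-trans (^-monoʳ-≤ D (m≤n+m∸n G e))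
      (≤-reflexive (trans (cong (D ^_) (+-comm e (G ∸ e))) (^-distribˡ-+-* D (G ∸ e) e)))
    layer-bound : ∀ e → D ^ G * (J * y) * (p ^ (G ∸ e) * X e) ≤ H * N * s * ((g + b) ^ (G ∸ e) * b ^ e)
    layer-bound e = begin
      D ^ G * (J * y) * (p ^ (G ∸ e) * X e)
        ≤⟨ *-monoˡ-≤ (p ^ (G ∸ e) * X e) (*-monoˡ-≤ (J * y) (D-split e)) ⟩
      D ^ (G ∸ e) * D ^ e * (J * y) * (p ^ (G ∸ e) * X e)
        ≡⟨ r₄ (D ^ (G ∸ e)) (D ^ e) J y (p ^ (G ∸ e)) (X e) ⟩
      D ^ (G ∸ e) * p ^ (G ∸ e) * (J * (y * D ^ e) * X e)
        ≡⟨ cong (_* (J * (y * D ^ e) * X e)) (trans (sym (^-distribʳ-* D p (G ∸ e))) (cong (_^ (G ∸ e)) (sym g+b))) ⟩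
      (g + b) ^ (G ∸ e) * (J * (y * D ^ e) * X e)
        ≤⟨ *-monoʳ-≤ ((g + b) ^ (G ∸ e)) (hyp (twist p e r) (s * b ^ e) (y * D ^ e)) ⟩
      (g + b) ^ (G ∸ e) * (H * N * (s * b ^ e))
        ≡⟨ r₅ ((g + b) ^ (G ∸ e)) (H * N) s (b ^ e) ⟩
      H * N * s * ((g + b) ^ (G ∸ e) * b ^ e) ∎

-- Distortion

2ab≤a²+b² : ∀ a b → 2 * (a * b) ≤ a * a + b * b
2ab≤a²+b² a b with ≤-total a b
... | inj₁ a≤b = subst (λ b → 2 * (a * b) ≤ a * a + b * b) (m+[n∸m]≡n a≤b)
  (≤-trans (m≤m+n _ ((b ∸ a) * (b ∸ a))) (≤-reflexive (square a (b ∸ a))))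
  where
  square : ∀ a d → 2 * (a * (a + d)) + d * d ≡ a * a + (a + d) * (a + d)
  square = solve-∀
... | inj₂ b≤a = subst (λ a → 2 * (a * b) ≤ a * a + b * b) (m+[n∸m]≡n b≤a)
  (≤-trans (m≤m+n _ ((a ∸ b) * (a ∸ b))) (≤-reflexive (square b (a ∸ b))))
  where
  square : ∀ b d → 2 * ((b + d) * b) + d * d ≡ (b + d) * (b + d) + b * b
  square = solve-∀

-- On a fibre with m points kept and c points discarded, the kept points are scaled by
-- min (1 + α) (6/5), where α = c / (m + c), in units of 1 / (5 (m + c)).  The factor
-- 1 / (1 - α) that would restore the mass is not needed: 1 + α loses only α².
density : ℕ → ℕ → ℕ
density m c = (5 * (m + c + c)) ⊓ (6 * (m + c))

density-mass : ∀ m c → m * density m c ≤ 5 * (m + c) * (m + c)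
density-mass m c = begin
  m * density m c                          ≤⟨ *-monoʳ-≤ m (m⊓n≤m (5 * (m + c + c)) (6 * (m + c))) ⟩
  m * (5 * (m + c + c))                    ≤⟨ m≤m+n _ (5 * (c * c)) ⟩
  m * (5 * (m + c + c)) + 5 * (c * c)      ≡⟨ square m c ⟩
  5 * (m + c) * (m + c)                    ∎
  where
  open ≤-Reasoning
  square : ∀ m c → m * (5 * (m + c + c)) + 5 * (c * c) ≡ 5 * (m + c) * (m + c)
  square = solve-∀

-- The loss is 5 c² where the cap 6/5 is inactive, and 9 c² - (m - 2 c)² where it is active.
density-loss : ∀ m c → 5 * (m + c) * (m + c) ≤ m * density m c + 9 * (c * c)
density-loss m c with ⊓-sel (5 * (m + c + c)) (6 * (m + c))
... | inj₁ eq rewrite eq = ≤-trans (m≤m+n _ (4 * (c * c))) (≤-reflexive (expand m c))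
  where
  expand : ∀ m c → 5 * (m + c) * (m + c) + 4 * (c * c) ≡ m * (5 * (m + c + c)) + 9 * (c * c)
  expand = solve-∀
... | inj₂ eq rewrite eq = begin
  5 * (m + c) * (m + c)                                            ≡⟨ expand₁ m c ⟩
  2 * (m * (2 * c)) + (5 * (m * m) + 6 * (m * c) + 5 * (c * c))    ≤⟨ +-monoˡ-≤ _ (2ab≤a²+b² m (2 * c)) ⟩
  m * m + 2 * c * (2 * c) + (5 * (m * m) + 6 * (m * c) + 5 * (c * c)) ≡⟨ expand₂ m c ⟩
  m * (6 * (m + c)) + 9 * (c * c)                                  ∎
  where
  open ≤-Reasoning
  expand₁ : ∀ m c → 5 * (m + c) * (m + c) ≡ 2 * (m * (2 * c)) + (5 * (m * m) + 6 * (m * c) + 5 * (c * c))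
  expand₁ = solve-∀
  expand₂ : ∀ m c → m * m + 2 * c * (2 * c) + (5 * (m * m) + 6 * (m * c) + 5 * (c * c)) ≡ m * (6 * (m + c)) + 9 * (c * c)
  expand₂ = solve-∀

-- The moduli of `extend p G L` in which `p` has a positive exponent.
fresh : ℕ → ℕ → List ℕ → List ℕ
fresh p G L = cartesianProductWith (λ e m → m * p ^ suc e) (downFrom G) L

∈-extend⁻ : ∀ {p G L d} → d ∈ extend p G L → d ∈ L ⊎ d ∈ fresh p G L
∈-extend⁻ {p} {G} {L} d∈ with ∈-cartesianProductWith⁻ (λ e m → m * p ^ e) (downFrom (suc G)) L d∈
... | zero  , m , _  , m∈L , refl = inj₁ (subst (_∈ L) (sym (*-identityʳ m)) m∈L)
... | suc e , m , e∈ , m∈L , refl = inj₂ (∈-cartesianProductWith⁺ (λ e m → m * p ^ suc e)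
        (∈-downFrom⁺ (s<s⁻¹ (∈-downFrom⁻ e∈))) m∈L)

module System {D : ℕ → Set} (D? : Decidable D) (r : ℕ → ℤ) where

  Hit : ℕ → ℕ → Set
  Hit d x = D d × d ∣ ℤ.∣ pos x ℤ.- r d ∣

  Hit? : ∀ x → Decidable (λ d → Hit d x)
  Hit? x d = D? d ×-dec (d ∣? _)

  Avoids : Measure → List ℕ → Set
  Avoids μ L = ∀ {w x} → (w , x) ∈ μ → w ≢ 0 → ∀ {d} → d ∈ L → ¬ Hit d x

  module Distortion {v Q : ℕ} (pp : Prime (suc v)) (p∤Q : ¬ suc v ∣ Q) (G : ℕ) {L : List ℕ}
    (L∣Q : ∀ {d} → d ∈ L → d ∣ Q) where

    open Steps {v} {Q} pp p∤Q G {L} L∣Q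

    hit miss : ℕ → ℕ
    hit x = 𝟙 (any? (Hit? x) (fresh p G L))
    miss x = 1 ∸ hit x

    #hit #miss : ℕ → ℕ
    #hit y = ∑ (downFrom q) (λ t → hit (y + Q * t))
    #miss y = ∑ (downFrom q) (λ t → miss (y + Q * t))

    #miss+#hit : ∀ y → #miss y + #hit y ≡ q
    #miss+#hit y = begin
      #miss y + #hit y                                                          ≡⟨ ∑-+ (downFrom q) _ _ ⟨
      ∑ (downFrom q) (λ t → miss (y + Q * t) + hit (y + Q * t))                 ≡⟨ ∑-cong (downFrom q) (λ t → m∸n+n≡m (𝟙≤1 (any? (Hit? (y + Q * t)) (fresh p G L)))) ⟩
      ∑ (downFrom q) (λ t → 1)                                                  ≡⟨ ∑-const q 1 ⟩
      q * 1                                                                     ≡⟨ *-identityʳ q ⟩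
      q                                                                         ∎
      where open ≡-Reasoning

    -- Hit points get weight zero. As the fibre has `q` points, the unit of `density` is 1 / (5 q),
    -- and the nominal mass of a fibre is `5 * q * q`.
    k : ℕ → ℕ → ℕ
    k y t = miss (y + Q * t) * density (#miss y) (#hit y)

    k≤ : ∀ y t → k y t ≤ 6 * q
    k≤ y t = begin
      miss (y + Q * t) * density (#miss y) (#hit y)   ≤⟨ *-mono-≤ (m∸n≤m 1 (hit (y + Q * t))) (m⊓n≤n (5 * (#miss y + #hit y + #hit y)) (6 * (#miss y + #hit y))) ⟩
      1 * (6 * (#miss y + #hit y))                    ≡⟨ *-identityˡ _ ⟩
      6 * (#miss y + #hit y)                          ≡⟨ cong (6 *_) (#miss+#hit y) ⟩
      6 * q                                           ∎
      where open ≤-Reasoning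

    ∑k : ∀ y → ∑ (downFrom q) (k y) ≡ #miss y * density (#miss y) (#hit y)
    ∑k y = ∑-*ʳ (downFrom q) _ _

    ∑k≤ : ∀ y → ∑ (downFrom q) (k y) ≤ 5 * q * q
    ∑k≤ y = begin
      ∑ (downFrom q) (k y)                                          ≡⟨ ∑k y ⟩
      #miss y * density (#miss y) (#hit y)                          ≤⟨ density-mass (#miss y) (#hit y) ⟩
      5 * (#miss y + #hit y) * (#miss y + #hit y)                   ≡⟨ cong (λ z → 5 * z * z) (#miss+#hit y) ⟩
      5 * q * q                                                     ∎
      where open ≤-Reasoning

    distort : Measure → Measure
    distort = spread Q q k

    distort-moment : ∀ {μ N C K} → Moment μ L N C K →
      Moment (distort μ) (extend p G L) (N * (5 * q * q)) (C * (5 * (v * v) + 6 * (3 * v + 2))) (K * (5 * (v * v)))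
    distort-moment {μ} {N} {C} {K} = moment-step′ k 6 5 q k≤ ∑k≤ {μ} {C} {K} {N}

    -- Union bound over the fresh moduli: the progression of `m * p ^ suc e` meets the fibre only if
    -- `y` lies in the twisted class modulo `m`, and then in at most `p ^ (G ∸ suc e)` points.
    #hit≤ : ∀ y → #hit y ≤ ∑ (downFrom G) (λ e → p ^ (G ∸ suc e) * S L (twist p (suc e) r) y)
    #hit≤ y = begin
      #hit y
        ≤⟨ ∑-mono (downFrom q) (λ t → ≤-trans (𝟙-any (Hit? (y + Q * t)) (fresh p G L))
             (∑-mono (fresh p G L) (λ d → 𝟙-mono (Hit? (y + Q * t) d) (_ ∣? _) proj₂))) ⟩
      ∑ (downFrom q) (λ t → ∑ (fresh p G L) (λ d → χ d (r d) (y + Q * t)))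
        ≡⟨ ∑-cong (downFrom q) (λ t → ∑-cartesianProductWith _ (downFrom G) L _) ⟩
      ∑ (downFrom q) (λ t → ∑ (downFrom G) (λ e → ∑ L (λ m → χ (m * p ^ suc e) (twist p (suc e) r m) (y + Q * t))))
        ≡⟨ trans (∑-swap (downFrom q) (downFrom G) _) (∑-cong (downFrom G) (λ e → ∑-swap (downFrom q) L _)) ⟩
      ∑ (downFrom G) (λ e → ∑ L (λ m → ∑ (downFrom q) (λ t → χ (m * p ^ suc e) (twist p (suc e) r m) (y + Q * t))))
        ≤⟨ ∑-mono (downFrom G) (λ e → ≤-trans
             (∑-mono-∈ L (λ {m} m∈L → ∑χ-fibre m∈L (suc e) (twist p (suc e) r m) y))
             (≤-reflexive (∑-*ˡ L (p ^ (G ∸ suc e)) _))) ⟩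
      ∑ (downFrom G) (λ e → p ^ (G ∸ suc e) * S L (twist p (suc e) r) y) ∎
      where open ≤-Reasoning

    -- Squaring the bound on `#hit` pairs twists of `r`, to which the moment bound applies. The
    -- powers of `p` sum to at most q / (p - 1) in each factor, whence the bound (C / K) / (p - 1)²
    -- for the mean of α².
    #hit²-moment : ∀ {μ N C K} → Moment μ L N C K →
      K * (v * v) * E μ (λ y → #hit y * #hit y) ≤ q * q * (C * N)
    #hit²-moment {μ} {N} {C} {K} hyp = begin
      K * (v * v) * E μ (λ y → #hit y * #hit y)
        ≤⟨ *-monoʳ-≤ (K * (v * v)) (E-mono μ (λ y → ≤-trans (*-mono-≤ (#hit≤ y) (#hit≤ y))
             (≤-reflexive (trans (∑-*-∑ Es Es _ _) (∑-cong Es (λ e → ∑-cong Es (λ e′ →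
               [m*n]*[o*p]≡[m*o]*[n*p] (g e) (S L (twist p (suc e) r) y) (g e′) (S L (twist p (suc e′) r) y)))))))) ⟩
      K * (v * v) * E μ (λ y → ∑ Es (λ e → ∑ Es (λ e′ → g e * g e′ * F e e′ y)))
        ≡⟨ cong (K * (v * v) *_) (trans (E-∑ μ Es _) (∑-cong Es (λ e → trans (E-∑ μ Es _) (∑-cong Es (λ e′ → E-*ˡ μ (g e * g e′) _))))) ⟩
      K * (v * v) * ∑ Es (λ e → ∑ Es (λ e′ → g e * g e′ * E μ (F e e′)))
        ≡⟨ r₁ K (v * v) _ ⟩
      v * v * (K * ∑ Es (λ e → ∑ Es (λ e′ → g e * g e′ * E μ (F e e′))))
        ≡⟨ cong (v * v *_) (sym (trans (∑-cong Es (λ e → ∑-*ˡ Es K _)) (∑-*ˡ Es K _))) ⟩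
      v * v * ∑ Es (λ e → ∑ Es (λ e′ → K * (g e * g e′ * E μ (F e e′))))
        ≤⟨ *-monoʳ-≤ (v * v) (∑-mono Es (λ e → ∑-mono Es (λ e′ → ≤-trans (≤-reflexive (*-swap K (g e * g e′) _))
             (*-monoʳ-≤ (g e * g e′) (hyp (twist p (suc e) r) (twist p (suc e′) r)))))) ⟩
      v * v * ∑ Es (λ e → ∑ Es (λ e′ → g e * g e′ * (C * N)))
        ≡⟨ cong (v * v *_) (trans (∑-cong Es (λ e → ∑-*ʳ Es (C * N) _)) (∑-*ʳ Es (C * N) _)) ⟩
      v * v * (∑ Es (λ e → ∑ Es (λ e′ → g e * g e′)) * (C * N))
        ≡⟨ cong (λ z → v * v * (z * (C * N))) (sym (∑-*-∑ Es Es g g)) ⟩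
      v * v * (∑ Es g * ∑ Es g * (C * N))
        ≡⟨ r₂ v (∑ Es g) (C * N) ⟩
      v * ∑ Es g * (v * ∑ Es g) * (C * N)
        ≤⟨ *-monoˡ-≤ (C * N) (*-mono-≤ v∑g≤q v∑g≤q) ⟩
      q * q * (C * N) ∎
      where
      open ≤-Reasoning
      Es = downFrom G
      g : ℕ → ℕ
      g e = p ^ (G ∸ suc e)
      F : ℕ → ℕ → ℕ → ℕ
      F e e′ y = S L (twist p (suc e) r) y * S L (twist p (suc e′) r) y
      r₁ : ∀ a b c → a * b * c ≡ b * (a * c)
      r₁ = solve-∀
      r₂ : ∀ v g c → v * v * (g * g * c) ≡ v * g * (v * g) * c
      r₂ = solve-∀
      v∑g≤q : v * ∑ Es g ≤ q
      v∑g≤q = ≤-trans (m≤m+n _ 1) (≤-reflexive (geometric-1 v G))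

    distort-mass : ∀ μ → 5 * q * q * E μ (λ _ → 1) ≤ E (distort μ) (λ _ → 1) + 9 * E μ (λ y → #hit y * #hit y)
    distort-mass μ = begin
      5 * q * q * E μ (λ _ → 1)
        ≡⟨ E-*ˡ μ (5 * q * q) _ ⟨
      E μ (λ _ → 5 * q * q * 1)
        ≤⟨ E-mono μ pointwise ⟩
      E μ (λ y → ∑ (downFrom q) (λ t → k y t * 1) + 9 * (#hit y * #hit y))
        ≡⟨ E-+ μ _ _ ⟩
      E μ (λ y → ∑ (downFrom q) (λ t → k y t * 1)) + E μ (λ y → 9 * (#hit y * #hit y))
        ≡⟨ cong₂ _+_ (sym (E-spread Q q k μ _)) (E-*ˡ μ 9 _) ⟩
      E (distort μ) (λ _ → 1) + 9 * E μ (λ y → #hit y * #hit y) ∎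
      where
      open ≤-Reasoning
      pointwise : ∀ y → 5 * q * q * 1 ≤ ∑ (downFrom q) (λ t → k y t * 1) + 9 * (#hit y * #hit y)
      pointwise y = begin
        5 * q * q * 1                                                       ≡⟨ *-identityʳ _ ⟩
        5 * q * q                                                           ≡⟨ cong (λ z → 5 * z * z) (sym (#miss+#hit y)) ⟩
        5 * (#miss y + #hit y) * (#miss y + #hit y)                         ≤⟨ density-loss (#miss y) (#hit y) ⟩
        #miss y * density (#miss y) (#hit y) + 9 * (#hit y * #hit y)        ≡⟨ cong (_+ 9 * (#hit y * #hit y)) (sym (trans (∑-cong (downFrom q) (λ t → *-identityʳ _)) (∑k y))) ⟩
        ∑ (downFrom q) (λ t → k y t * 1) + 9 * (#hit y * #hit y)            ∎

    -- For a modulus in `L` a hit at `y + Q * t` is a hit at `y`, excluded before; for a fresh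
    -- modulus the kernel vanishes at the hit point.
    distort-avoids : ∀ {μ} → Avoids μ L → Avoids (distort μ) (extend p G L)
    distort-avoids {μ} avoids wx∈ w≢0 {d} d∈ hitd
      with (w , y) , wy∈ , wx∈′ ← find (∈-concatMap⁻ _ {xs = μ} wx∈)
      with t , _ , refl ← ∈-map⁻ _ wx∈′
      with ∈-extend⁻ {p} {G} d∈
    ... | inj₁ d∈L = avoids wy∈ (λ { refl → w≢0 refl }) d∈L (proj₁ hitd , ∣-shift (L∣Q d∈L) (r d) y t (proj₂ hitd))
    ... | inj₂ d∈new = w≢0 (trans (cong (λ h → w * ((1 ∸ h) * density (#miss y) (#hit y)))
            (𝟙-yes (any? (Hit? (y + Q * t)) (fresh p G L)) (lose d∈new hitd))) (*-zeroʳ w))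

-- Frames: the progressions with smooth moduli

-- All primes below n have been treated, with exponents up to G.
record Frame (G n : ℕ) : Set where
  field
    Q        : ℕ
    L        : List ℕ
    L∣Q      : ∀ {d} → d ∈ L → d ∣ Q
    smooth   : ∀ {p} → Prime p → p ∣ Q → p < n
    complete : ∀ d → .{{NonZero d}} → d ≤ G → (∀ {p} → Prime p → p ∣ d → p < n) → d ∈ L

open Frame

fresh-prime : ∀ {G n} (F : Frame G n) → Prime n → ¬ n ∣ Q F
fresh-prime F pn n∣Q = <-irrefl refl (smooth F pn n∣Q)

prime∣^⇒∣ : ∀ {p} → Prime p → ∀ m k → p ∣ m ^ k → p ∣ m
prime∣^⇒∣ pp m zero    h = contradiction (subst Prime (∣1⇒≡1 h) pp) ¬prime[1]
prime∣^⇒∣ pp m (suc k) h = [ (λ x → x) , prime∣^⇒∣ pp m k ] (euclidsLemma m (m ^ k) pp h)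

prime-factor : ∀ d .{{_ : NonZero d}} → d ≡ 1 ⊎ ∃[ p ] Prime p × p ∣ d
prime-factor d with factorise d
... | record { factors = [] ; isFactorisation = eq } = inj₁ eq
... | record { factors = p ∷ ps ; isFactorisation = eq ; factorsPrime = pp ∷ _ } =
  inj₂ (p , pp , subst (p ∣_) (sym eq) (m∣m*n (product ps)))

-- The crude bound on `e` is what completeness of a frame uses: exponents up to `G` reach every
-- modulus up to `G`.
remove-prime : ∀ {p} → Prime p → ∀ d → .{{NonZero d}} → ∃[ m ] ∃[ e ] d ≡ m * p ^ e × ¬ p ∣ m × e ≤ d
remove-prime {p} pp = <-rec _ go
  where
  c<c*p : ∀ c → suc c < suc c * p
  c<c*p c = m<m*n (suc c) p (nonTrivial⇒n>1 p {{prime⇒nonTrivial pp}})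
  regroup : ∀ m q p → m * q * p ≡ m * (p * q)
  regroup = solve-∀
  go : ∀ d → (∀ {d′} → d′ < d → .{{NonZero d′}} → ∃[ m ] ∃[ e ] d′ ≡ m * p ^ e × ¬ p ∣ m × e ≤ d′) →
    .{{NonZero d}} → ∃[ m ] ∃[ e ] d ≡ m * p ^ e × ¬ p ∣ m × e ≤ d
  go d rec with p ∣? d
  ... | no  p∤d = d , 0 , sym (*-identityʳ d) , p∤d , z≤n
  ... | yes (divides zero    refl) = contradiction refl (≢-nonZero⁻¹ 0)
  ... | yes (divides (suc c) refl) with m , e , eq , p∤m , e≤ ← rec (c<c*p c) =
    m , suc e , trans (cong (_* p) eq) (regroup m (p ^ e) p) , p∤m , ≤-trans (s≤s e≤) (c<c*p c)

initial-frame : ∀ G → Frame G 2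
initial-frame G = record
  { Q = 1
  ; L = 1 ∷ []
  ; L∣Q = λ { (here refl) → ∣-refl }
  ; smooth = λ pp p∣1 → contradiction (subst Prime (∣1⇒≡1 p∣1) pp) ¬prime[1]
  ; complete = complete₂
  }
  where
  complete₂ : ∀ d → .{{NonZero d}} → d ≤ G → (∀ {p} → Prime p → p ∣ d → p < 2) → d ∈ 1 ∷ []
  complete₂ d _ sm with prime-factor d
  ... | inj₁ d≡1            = here d≡1
  ... | inj₂ (p , pp , p∣d) = contradiction (nonTrivial⇒n>1 p {{prime⇒nonTrivial pp}}) (<⇒≱ (sm pp p∣d))

skip-frame : ∀ {G n} → ¬ Prime n → Frame G n → Frame G (suc n)
skip-frame {G} {n} ¬pn F = record
  { Q = Q F
  ; L = L F
  ; L∣Q = L∣Q F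
  ; smooth = λ pp p∣Q → m<n⇒m<1+n (smooth F pp p∣Q)
  ; complete = λ d d≤G sm → complete F d d≤G (λ pp p∣d →
      ≤∧≢⇒< (s≤s⁻¹ (sm pp p∣d)) (λ { refl → ¬pn pp }))
  }

extend-frame : ∀ {G n} → Prime n → Frame G n → Frame G (suc n)
extend-frame {G} {n} pn F = record
  { Q = Q F * n ^ G
  ; L = extend n G (L F)
  ; L∣Q = divides-new
  ; smooth = smooth-new
  ; complete = complete-new
  }
  where
  divides-new : ∀ {d} → d ∈ extend n G (L F) → d ∣ Q F * n ^ G
  divides-new d∈ with ∈-cartesianProductWith⁻ (λ e m → m * n ^ e) (downFrom (suc G)) (L F) d∈
  ... | e , m , e∈ , m∈L , refl = *-pres-∣ (L∣Q F m∈L)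
    (subst (λ k → n ^ e ∣ n ^ k) (m+[n∸m]≡n (s≤s⁻¹ (∈-downFrom⁻ e∈)))
      (subst (n ^ e ∣_) (sym (^-distribˡ-+-* n e (G ∸ e))) (m∣m*n (n ^ (G ∸ e)))))
  smooth-new : ∀ {p} → Prime p → p ∣ Q F * n ^ G → p < suc n
  smooth-new pp h with euclidsLemma (Q F) (n ^ G) pp h
  ... | inj₁ p∣Q = m<n⇒m<1+n (smooth F pp p∣Q)
  ... | inj₂ p∣n = s≤s (∣⇒≤ {{prime⇒nonZero pn}} (prime∣^⇒∣ pp n G p∣n))
  complete-new : ∀ d → .{{NonZero d}} → d ≤ G → (∀ {p} → Prime p → p ∣ d → p < suc n) → d ∈ extend n G (L F)
  complete-new d d≤G sm with remove-prime pn d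
  ... | zero  , e , eq , _ , _     = contradiction eq (≢-nonZero⁻¹ d)
  ... | m@(suc _) , e , refl , n∤m , e≤ = ∈-cartesianProductWith⁺ (λ e m → m * n ^ e)
    (∈-downFrom⁺ (s≤s (≤-trans e≤ d≤G)))
    (complete F m (≤-trans (m≤m*n m (n ^ e) {{m^n≢0 n e {{prime⇒nonZero pn}}}}) d≤G)
      (λ pp p∣m → ≤∧≢⇒< (s≤s⁻¹ (sm pp (∣-trans p∣m (m∣m*n (n ^ e))))) (λ { refl → n∤m p∣m })))

-- Counting residues coprime to 210

coprime210 : ℕ → Bool
coprime210 n = (0 <ᵇ n % 2) ∧ (0 <ᵇ n % 3) ∧ (0 <ᵇ n % 5) ∧ (0 <ᵇ n % 7)

#coprime210 : ℕ → ℕ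
#coprime210 zero    = 0
#coprime210 (suc n) = (if coprime210 n then 1 else 0) + #coprime210 n

coprime210-periodic : ∀ n → coprime210 (n + 210) ≡ coprime210 n
coprime210-periodic n = cong₂ _∧_ (period 105 2) (cong₂ _∧_ (period 70 3) (cong₂ _∧_ (period 42 5) (period 30 7)))
  where
  period : ∀ k d .{{_ : NonZero d}} → (0 <ᵇ (n + k * d) % d) ≡ (0 <ᵇ n % d)
  period k d = cong (0 <ᵇ_) ([m+kn]%n≡m%n n k d)

#coprime210-periodic : ∀ n → #coprime210 (n + 210) ≡ 48 + #coprime210 n
#coprime210-periodic zero    = refl
#coprime210-periodic (suc n) = trans
  (cong₂ _+_ (cong (λ b → if b then 1 else 0) (coprime210-periodic n)) (#coprime210-periodic n))
  (+-swap (if coprime210 n then 1 else 0) 48 (#coprime210 n))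
  where
  +-swap : ∀ a b c → a + (b + c) ≡ b + (a + c)
  +-swap = solve-∀

-- A period holds 48 = φ(210) coprime residues, which is the density 8/35; the constant 45 absorbs
-- the deviation within one period, checked by evaluation.
#coprime210-bound : ∀ n → 35 * #coprime210 n ≤ 8 * n + 45
#coprime210-bound n = subst (λ n → 35 * #coprime210 n ≤ 8 * n + 45) (sym (m≡m%n+[m/n]*n n 210)) (go (n / 210))
  where
  open ≤-Reasoning
  base : ∀ {m} → m < 210 → 35 * #coprime210 m ≤ 8 * m + 45
  base = toWitness {a? = allUpTo? (λ m → 35 * #coprime210 m ≤? 8 * m + 45) 210} _
  go : ∀ k → 35 * #coprime210 (n % 210 + k * 210) ≤ 8 * (n % 210 + k * 210) + 45
  go zero    = subst (λ m → 35 * #coprime210 m ≤ 8 * m + 45) (sym (+-identityʳ (n % 210))) (base (m%n<n n 210))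
  go (suc k) = subst (λ m → 35 * #coprime210 m ≤ 8 * m + 45) (sym (next (n % 210) k)) (begin
    35 * #coprime210 (m + 210)     ≡⟨ cong (35 *_) (#coprime210-periodic m) ⟩
    35 * (48 + #coprime210 m)      ≡⟨ *-distribˡ-+ 35 48 (#coprime210 m) ⟩
    1680 + 35 * #coprime210 m      ≤⟨ +-monoʳ-≤ 1680 (go k) ⟩
    1680 + (8 * m + 45)            ≡⟨ regroup m ⟩
    8 * (m + 210) + 45             ∎)
    where
    m = n % 210 + k * 210
    next : ∀ j k → j + suc k * 210 ≡ j + k * 210 + 210
    next = solve-∀
    regroup : ∀ m → 1680 + (8 * m + 45) ≡ 8 * (m + 210) + 45
    regroup = solve-∀

0<ᵇ-intro : ∀ n → n ≢ 0 → T (0 <ᵇ n)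
0<ᵇ-intro n n≢0 = <⇒<ᵇ (n≢0⇒n>0 n≢0)

prime⇒%≢0 : ∀ {n} → Prime n → ∀ d .{{_ : NonZero d}} → 1 < d → d < n → n % d ≢ 0
prime⇒%≢0 {n} pn d 1<d d<n eq with prime⇒irreducible pn (m%n≡0⇒n∣m n d eq)
... | inj₁ d≡1 = <⇒≢ 1<d (sym d≡1)
... | inj₂ d≡n = <⇒≢ d<n d≡n

prime⇒coprime210 : ∀ {n} → Prime n → 7 < n → coprime210 n ≡ true
prime⇒coprime210 {n} pn 7<n = T⇒≡ (∧-intro (avoid 2 (s≤s (s≤s z≤n)) (toWitness {a? = 2 ≤? 7} _))
  (∧-intro (avoid 3 (s≤s (s≤s z≤n)) (toWitness {a? = 3 ≤? 7} _))
  (∧-intro (avoid 5 (s≤s (s≤s z≤n)) (toWitness {a? = 5 ≤? 7} _)) (avoid 7 (s≤s (s≤s z≤n)) ≤-refl))))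
  where
  T⇒≡ : ∀ {b} → T b → b ≡ true
  T⇒≡ {true} _ = refl
  ∧-intro : ∀ {a b} → T a → T b → T (a ∧ b)
  ∧-intro p q = Equivalence.from T-∧ (p , q)
  avoid : ∀ d .{{_ : NonZero d}} → 1 < d → d ≤ 7 → T (0 <ᵇ n % d)
  avoid d 1<d d≤7 = 0<ᵇ-intro (n % d) (prime⇒%≢0 pn d 1<d (≤-<-trans d≤7 7<n))

-- Arithmetic of the potential

-- As `35 * w ≤ 8 * v + 53`, the left side times 35² has leading term (5040 + 960) v², against 6125
-- v² on the right. The surplus 125 v² is split as 100 + 25 to absorb the linear and the constant
-- term.
potential-gap : ∀ v → 12599 ≤ v → let w = #coprime210 (suc v) in
  w * (6 * (3 * v + 2)) + 15 * (w * suc w) ≤ 5 * (v * v)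
potential-gap v v≥ = *-cancelˡ-≤ 1225 (begin
  1225 * (w * (6 * (3 * v + 2)) + 15 * (w * suc w))
    ≡⟨ r₁ w v ⟩
  35 * w * (35 * (6 * (3 * v + 2))) + 15 * (35 * w * (35 * w + 35))
    ≤⟨ +-mono-≤ (*-monoˡ-≤ _ 35w≤) (*-monoʳ-≤ 15 (*-mono-≤ 35w≤ (+-monoˡ-≤ 35 35w≤))) ⟩
  (8 * v + 53) * (35 * (6 * (3 * v + 2))) + 15 * ((8 * v + 53) * (8 * v + 53 + 35))
    ≡⟨ r₂ v ⟩
  6000 * (v * v) + 53670 * v + 92220 * 1
    ≤⟨ +-mono-≤ (+-monoʳ-≤ (6000 * (v * v)) (*-monoˡ-≤ v 53670≤)) (*-monoʳ-≤ 92220 {1} {v} 1≤v) ⟩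
  6000 * (v * v) + 100 * v * v + 92220 * v
    ≤⟨ +-monoʳ-≤ (6000 * (v * v) + 100 * v * v) (*-monoˡ-≤ v 92220≤) ⟩
  6000 * (v * v) + 100 * v * v + 25 * v * v
    ≡⟨ r₃ v ⟩
  1225 * (5 * (v * v)) ∎)
  where
  open ≤-Reasoning
  w = #coprime210 (suc v)
  r₁ : ∀ w v → 1225 * (w * (6 * (3 * v + 2)) + 15 * (w * suc w))
    ≡ 35 * w * (35 * (6 * (3 * v + 2))) + 15 * (35 * w * (35 * w + 35))
  r₁ = solve-∀
  r₂ : ∀ v → (8 * v + 53) * (35 * (6 * (3 * v + 2))) + 15 * ((8 * v + 53) * (8 * v + 53 + 35))
    ≡ 6000 * (v * v) + 53670 * v + 92220 * 1
  r₂ = solve-∀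
  r₃ : ∀ v → 6000 * (v * v) + 100 * v * v + 25 * v * v ≡ 1225 * (5 * (v * v))
  r₃ = solve-∀
  35w≤ : 35 * w ≤ 8 * v + 53
  35w≤ = ≤-trans (#coprime210-bound (suc v)) (≤-reflexive (shift v))
    where
    shift : ∀ v → 8 * suc v + 45 ≡ 8 * v + 53
    shift = solve-∀
  1≤v : 1 ≤ v
  1≤v = ≤-trans (toWitness {a? = 1 ≤? 12599} _) v≥
  53670≤ : 53670 ≤ 100 * v
  53670≤ = ≤-trans (toWitness {a? = 53670 ≤? 100 * 12599} _) (*-monoʳ-≤ 100 v≥)
  92220≤ : 92220 ≤ 25 * v
  92220≤ = ≤-trans (toWitness {a? = 92220 ≤? 25 * 12599} _) (*-monoʳ-≤ 25 v≥)

-- With ρ = C / K the invariant is M / N > (3/5) ρ / w. The step loses at most (9/5) ρ / u of the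
-- relative mass, multiplies ρ by 1 + s / (5 u) and raises w by one. The last hypothesis is (3/5) ρ
-- / w - (9/5) ρ / u ≥ (3/5) ρ (1 + s / (5 u)) / (w + 1), cleared of denominators.
potential-step : ∀ C K N M M′ V q u s w .{{_ : NonZero q}} .{{_ : NonZero u}} →
  3 * (C * N) < 5 * (K * (w * M)) →
  5 * q * q * M ≤ M′ + 9 * V →
  K * u * V ≤ q * q * (C * N) →
  w * s + 15 * (w * suc w) ≤ 5 * u →
  3 * (C * (5 * u + s) * (N * (5 * q * q))) < 5 * (K * (5 * u) * (suc w * M′))
potential-step C K N M M′ V q u s w mass loss moment gap =
  -- The scaled loss is added to both sides to avoid a subtraction.
  *-cancelˡ-< w _ _ (+-cancelʳ-< (45 * (w * suc w) * (5 * q * q * (C * N))) _ _ (begin-strict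
    w * (3 * (C * (5 * u + s) * (N * (5 * q * q)))) + 45 * (w * suc w) * (5 * q * q * (C * N))
      ≡⟨ r₁ w C u s N (5 * q * q) ⟩
    3 * (5 * q * q * (C * N)) * (5 * u * w + (w * s + 15 * (w * suc w)))
      ≤⟨ *-monoʳ-≤ (3 * (5 * q * q * (C * N))) (+-monoʳ-≤ (5 * u * w) gap) ⟩
    3 * (5 * q * q * (C * N)) * (5 * u * w + 5 * u)
      ≡⟨ r₂ q (C * N) u w ⟩
    u * q * q * (25 * suc w) * (3 * (C * N))
      <⟨ *-monoʳ-< (u * q * q * (25 * suc w)) {{nz}} mass ⟩
    u * q * q * (25 * suc w) * (5 * (K * (w * M)))
      ≡⟨ r₃ u q w K M ⟩
    25 * (w * suc w) * (K * u) * (5 * q * q * M)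
      ≤⟨ *-monoʳ-≤ (25 * (w * suc w) * (K * u)) loss ⟩
    25 * (w * suc w) * (K * u) * (M′ + 9 * V)
      ≡⟨ r₄ w K u M′ V ⟩
    w * (5 * (K * (5 * u) * (suc w * M′))) + 225 * (w * suc w) * (K * u * V)
      ≤⟨ +-monoʳ-≤ (w * (5 * (K * (5 * u) * (suc w * M′)))) (*-monoʳ-≤ (225 * (w * suc w)) moment) ⟩
    w * (5 * (K * (5 * u) * (suc w * M′))) + 225 * (w * suc w) * (q * q * (C * N))
      ≡⟨ cong (w * (5 * (K * (5 * u) * (suc w * M′))) +_) (r₅ w q (C * N)) ⟩
    w * (5 * (K * (5 * u) * (suc w * M′))) + 45 * (w * suc w) * (5 * q * q * (C * N)) ∎))
  where
  open ≤-Reasoning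
  nz : NonZero (u * q * q * (25 * suc w))
  nz = m*n≢0 (u * q * q) (25 * suc w) {{m*n≢0 (u * q) q {{m*n≢0 u q}}}}
  r₁ : ∀ w C u s N T → w * (3 * (C * (5 * u + s) * (N * T))) + 45 * (w * suc w) * (T * (C * N))
    ≡ 3 * (T * (C * N)) * (5 * u * w + (w * s + 15 * (w * suc w)))
  r₁ = solve-∀
  r₂ : ∀ q A u w → 3 * (5 * q * q * A) * (5 * u * w + 5 * u) ≡ u * q * q * (25 * suc w) * (3 * A)
  r₂ = solve-∀
  r₃ : ∀ u q w K M → u * q * q * (25 * suc w) * (5 * (K * (w * M))) ≡ 25 * (w * suc w) * (K * u) * (5 * q * q * M)
  r₃ = solve-∀
  r₄ : ∀ w K u M′ V → 25 * (w * suc w) * (K * u) * (M′ + 9 * V)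
    ≡ w * (5 * (K * (5 * u) * (suc w * M′))) + 225 * (w * suc w) * (K * u * V)
  r₄ = solve-∀
  r₅ : ∀ w q A → 225 * (w * suc w) * (q * q * A) ≡ 45 * (w * suc w) * (5 * q * q * A)
  r₅ = solve-∀

-- The uniform phase

-- `C / K` bounds the second moments and `H / K` is the Rankin constant; with a common denominator
-- the certificate computes with numerators alone.
record Uniform (G K n C H : ℕ) : Set where
  field
    frame  : Frame G n
    μ      : Measure
    N      : ℕ
    N>0    : 0 < N
    mass   : N ≤ E μ (λ _ → 1)
    moment : Moment μ (L frame) N C K
    rankin : Rankin μ (L frame) N H K

cube-cancel-≤ : ∀ {x y} → cube x ≤ cube y → x ≤ y
cube-cancel-≤ {x} {y} h with x ≤? y
... | yes x≤y = x≤y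
... | no  x≰y = contradiction h (<⇒≱ (*-mono-< (*-mono-< (≰⇒> x≰y) (≰⇒> x≰y)) (≰⇒> x≰y)))

initial-uniform : ∀ G K → Uniform G K 2 K K
initial-uniform G K = record
  { frame = initial-frame G
  ; μ = (1 , 0) ∷ []
  ; N = 1
  ; N>0 = ≤-refl
  ; mass = ≤-refl
  ; moment = λ r r′ → *-monoʳ-≤ K (≤-trans (≤-reflexive (trans (+-identityʳ _) (*-identityˡ _)))
      (*-mono-≤ (S≤1 r) (S≤1 r′)))
  ; rankin = rankin₂
  }
  where
  S≤1 : ∀ r → S (1 ∷ []) r 0 ≤ 1
  S≤1 r = ≤-trans (≤-reflexive (+-identityʳ _)) (χ≤1 1 (r 1) 0)
  rankin₂ : Rankin ((1 , 0) ∷ []) (1 ∷ []) 1 K K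
  rankin₂ r s y with cube y ≤? 1 * cube s
  ... | no  _ = ≤-trans (≤-reflexive (*-zeroʳ (K * y))) z≤n
  -- For the single modulus 1 the threshold reads y³ ≤ s³, hence y ≤ s.
  ... | yes h = begin
    K * y * (1 * (1 * χ 1 (r 1) 0 + 0) + 0)   ≡⟨ r₁ (K * y) (χ 1 (r 1) 0) ⟩
    K * y * χ 1 (r 1) 0                       ≤⟨ *-mono-≤ (*-monoʳ-≤ K (cube-cancel-≤ (≤-trans h (≤-reflexive (*-identityˡ _))))) (χ≤1 1 (r 1) 0) ⟩
    K * s * 1                                 ≡⟨ r₂ K s ⟩
    K * 1 * s                                 ∎
    where
    open ≤-Reasoning
    r₁ : ∀ a c → a * (1 * (1 * c + 0) + 0) ≡ a * c
    r₁ = solve-∀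
    r₂ : ∀ K s → K * s * 1 ≡ K * 1 * s
    r₂ = solve-∀

moment-mono : ∀ {μ L N C C′ K} → C ≤ C′ → Moment μ L N C K → Moment μ L N C′ K
moment-mono {N = N} C≤C′ h r r′ = ≤-trans (h r r′) (*-monoˡ-≤ N C≤C′)

rankin-mono : ∀ {μ L N H H′ J} → H ≤ H′ → Rankin μ L N H J → Rankin μ L N H′ J
rankin-mono {N = N} H≤H′ h r s y = ≤-trans (h r s y) (*-monoˡ-≤ s (*-monoˡ-≤ N H≤H′))

moment-round : ∀ {μ L N C C′ K a} u .{{_ : NonZero u}} → C * a ≤ C′ * u →
  Moment μ L N (C * a) (K * u) → Moment μ L N C′ K
moment-round {μ} {L} {N} {C} {C′} {K} {a} u Ca≤ h r r′ = *-cancelˡ-≤ u (begin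
  u * (K * X)         ≡⟨ r₁ u K X ⟩
  K * u * X           ≤⟨ h r r′ ⟩
  C * a * N           ≤⟨ *-monoˡ-≤ N Ca≤ ⟩
  C′ * u * N          ≡⟨ r₂ C′ u N ⟩
  u * (C′ * N)        ∎)
  where
  open ≤-Reasoning
  X = E μ (λ x → S L r x * S L r′ x)
  r₁ : ∀ u K X → u * (K * X) ≡ K * u * X
  r₁ = solve-∀
  r₂ : ∀ C u N → C * u * N ≡ u * (C * N)
  r₂ = solve-∀

rankin-round : ∀ {μ L N H H′ J a} g .{{_ : NonZero g}} → H * a ≤ H′ * g →
  Rankin μ L N (H * a) (J * g) → Rankin μ L N H′ J
rankin-round {μ} {L} {N} {H} {H′} {J} {a} g Ha≤ h r s y = *-cancelˡ-≤ g (begin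
  g * (J * y * X)         ≡⟨ r₁ g J y X ⟩
  J * g * y * X           ≤⟨ h r s y ⟩
  H * a * N * s           ≤⟨ *-monoˡ-≤ s (*-monoˡ-≤ N Ha≤) ⟩
  H′ * g * N * s          ≡⟨ r₂ H′ g N s ⟩
  g * (H′ * N * s)        ∎)
  where
  open ≤-Reasoning
  X = ∑ L (λ d → 𝟙 (cube y ≤? d * cube s) * E μ (χ d (r d)))
  r₁ : ∀ g J y X → g * (J * y * X) ≡ J * g * y * X
  r₁ = solve-∀
  r₂ : ∀ H g N s → H * g * N * s ≡ g * (H * N * s)
  r₂ = solve-∀

uniform-skip : ∀ {G K n C C′ H H′} → ¬ Prime n → C ≤ C′ → H ≤ H′ → Uniform G K n C H → Uniform G K (suc n) C′ H′
uniform-skip {K = K} ¬pn C≤C′ H≤H′ U = record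
  { frame = skip-frame ¬pn frame
  ; μ = μ
  ; N = N
  ; N>0 = N>0
  ; mass = mass
  ; moment = moment-mono {μ} {L frame} {K = K} C≤C′ moment
  ; rankin = rankin-mono {μ} {L frame} {J = K} H≤H′ rankin
  }
  where open Uniform U

uniform-step : ∀ {G K v C C′ H H′} → let p = suc v in .{{_ : NonZero (v * v)}} → Prime p →
  C * (v * v + (3 * v + 2)) ≤ C′ * (v * v) →
  ∀ D .{{_ : NonZero D}} b g .{{_ : NonZero g}} →
  p * cube D ≤ cube b → g + b ≡ D * p → H * (D * p) ≤ H′ * g →
  Uniform G K p C H → Uniform G K (suc p) C′ H′
uniform-step {G} {K} {v} {C} {C′} {H} {H′} pp C≤ D b g root g+b H≤ U = record
  { frame = extend-frame pp frame
  ; μ = spread (Q frame) q uniform μ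
  ; N = N * q
  ; N>0 = *-mono-≤ N>0 (m^n>0 (suc v) G)
  ; mass = begin
      N * q                                                         ≤⟨ *-monoˡ-≤ q mass ⟩
      E μ (λ _ → 1) * q                                             ≡⟨ *-comm _ q ⟩
      q * E μ (λ _ → 1)                                             ≡⟨ E-*ˡ μ q _ ⟨
      E μ (λ _ → q * 1)                                             ≤⟨ E-mono μ (λ _ → ≤-reflexive (sym (∑-const q 1))) ⟩
      E μ (λ _ → ∑ (downFrom q) (λ _ → 1 * 1))                      ≡⟨ E-spread (Q frame) q uniform μ _ ⟨
      E (spread (Q frame) q uniform μ) (λ _ → 1)                    ∎
  ; moment = moment-round {μ = spread (Q frame) q uniform μ} {L = extend (suc v) G (L frame)} {C = C} {C′ = C′} {K = K} {a = v * v + (3 * v + 2)} (v * v) C≤ moment′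
  ; rankin = rankin-round {μ = spread (Q frame) q uniform μ} {L = extend (suc v) G (L frame)} {H = H} {H′ = H′} {J = K} {a = D * suc v} g H≤
      (rankin-step {μ} {N} {H} {K} D b g root g+b rankin)
  }
  where
  open ≤-Reasoning
  open Uniform U
  open Steps {v} {Q frame} pp (fresh-prime frame pp) G {L frame} (L∣Q frame)
  moment′ : Moment (spread (Q frame) q uniform μ) (extend (suc v) G (L frame)) (N * q) (C * (v * v + (3 * v + 2))) (K * (v * v))
  moment′ r r′ = begin
    K * (v * v) * X                                             ≡⟨ cong (λ z → K * z * X) (sym (*-identityˡ (v * v))) ⟩
    K * (1 * (v * v)) * X                                       ≤⟨ moment-step′ uniform 1 1 1 (λ _ _ → ≤-refl) (λ _ → ≤-reflexive (trans (∑-const q 1) (*-comm q 1))) {μ} {C} {K} {N} moment r r′ ⟩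
    C * (1 * (v * v) + 1 * (3 * v + 2)) * (N * (1 * 1 * q))     ≡⟨ simplify C (v * v) (3 * v + 2) N q ⟩
    C * (v * v + (3 * v + 2)) * (N * q)                         ∎
    where
    X = E (spread (Q frame) q uniform μ) (λ x → S (extend (suc v) G (L frame)) r x * S (extend (suc v) G (L frame)) r′ x)
    simplify : ∀ C u s N q → C * (1 * u + 1 * s) * (N * (1 * 1 * q)) ≡ C * (u + s) * (N * q)
    simplify = solve-∀

-- A certified computation of the constants

-- Trial division by 2, ..., 59. Some composite numbers pass; treating them like primes only raises
-- the constants.
survives : ℕ → Bool
survives n = all (λ j → (n ≤ᵇ 2 + j) ∨ (0 <ᵇ n % (2 + j))) (upTo 58)

prime⇒survives : ∀ {n} → Prime n → T (survives n)
prime⇒survives {n} pn = all-intro (upTo 58)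
  where
  test : ∀ j → T ((n ≤ᵇ 2 + j) ∨ (0 <ᵇ n % (2 + j)))
  test j with n ≤? 2 + j
  ... | yes n≤ = Equivalence.from T-∨ (inj₁ (≤⇒≤ᵇ n≤))
  ... | no  n≰ = Equivalence.from T-∨ (inj₂ (0<ᵇ-intro (n % (2 + j)) (prime⇒%≢0 pn (2 + j) (s≤s (s≤s z≤n)) (≰⇒> n≰))))
  all-intro : ∀ js → T (all (λ j → (n ≤ᵇ 2 + j) ∨ (0 <ᵇ n % (2 + j))) js)
  all-intro []       = _
  all-intro (j ∷ js) = Equivalence.from T-∧ (test j , all-intro js)

m≤⌈m/n⌉*n : ∀ m n .{{_ : NonZero n}} → m ≤ suc (m / n) * n
m≤⌈m/n⌉*n m n = begin
  m                        ≡⟨ m≡m%n+[m/n]*n m n ⟩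
  m % n + (m / n) * n      ≤⟨ +-monoˡ-≤ _ (<⇒≤ (m%n<n m n)) ⟩
  n + (m / n) * n          ∎
  where open ≤-Reasoning

-- The constants are rounded up to multiples of 1 / K.  The last argument b of run and step
-- is an upper approximation of 16 * p ^ (1/3), raised by search as p = 2 + i grows; its
-- correctness is tested in step, so that search needs no specification.
search : ℕ → ℕ → ℕ → ℕ
search zero    c b = b
search (suc f) c b = if c ≤ᵇ cube b then b else search f c (suc b)

-- The growth factor is 1 + (3 p - 1) / (p - 1)² at p = `2 + i`.
nextC : ℕ → ℕ → ℕ
nextC i C = suc ((C * (suc i * suc i + (3 * suc i + 2))) / (suc i * suc i))

-- For `b < 16 * (2 + i)` the divisor is the difference of the two, the `g` of `rankin-step` with
-- `D` = 16, written as a successor so that it is visibly nonzero.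
nextH : ℕ → ℕ → ℕ → ℕ
nextH i H b = suc ((H * (16 * (2 + i))) / suc (16 * (2 + i) ∸ suc b))

T-if : ∀ b {x y} → T (if b then x else y) → (T b × T x) ⊎ (¬ T b × T y)
T-if true  h = inj₁ (_ , h)
T-if false h = inj₂ ((λ ()) , h)

round-increases : ∀ {x y a u} .{{_ : NonZero u}} → u ≤ a → x * a ≤ y * u → x ≤ y
round-increases {x} {y} {a} {u} u≤a h = *-cancelʳ-≤ x y u (≤-trans (*-monoʳ-≤ x u≤a) h)

module Certificate (test : ℕ → Bool) (prime⇒test : ∀ {n} → Prime n → T (test n)) where

  run  : ℕ → ℕ → ℕ → ℕ → ℕ → ℕ → ℕ → Bool
  step : ℕ → ℕ → ℕ → ℕ → ℕ → ℕ → ℕ → Bool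

  run C∞ H∞ zero    i C H b = (C ≤ᵇ C∞) ∧ (H ≤ᵇ H∞)
  run C∞ H∞ (suc k) i C H b =
    if test (2 + i) then step C∞ H∞ k i C H (search 10 ((2 + i) * cube 16) b) else run C∞ H∞ k (suc i) C H b

  step C∞ H∞ k i C H b =
    ((2 + i) * cube 16 ≤ᵇ cube b) ∧ (b <ᵇ 16 * (2 + i)) ∧ run C∞ H∞ k (suc i) (nextC i C) (nextH i H b) b

  run-sound : ∀ {G K C∞ H∞} k i C H b → Uniform G K (2 + i) C H → T (run C∞ H∞ k i C H b) →
    Uniform G K (k + (2 + i)) C∞ H∞
  step-sound : ∀ {G K C∞ H∞} k i C H b → Uniform G K (2 + i) C H → T (step C∞ H∞ k i C H b) →
    Uniform G K (suc k + (2 + i)) C∞ H∞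

  run-sound {K = K} {C∞} {H∞} zero i C H b U ok = record
    { frame = frame ; μ = μ ; N = N ; N>0 = N>0 ; mass = mass
    ; moment = moment-mono {μ} {L frame} {K = K} (≤ᵇ⇒≤ C C∞ (proj₁ both)) moment
    ; rankin = rankin-mono {μ} {L frame} {J = K} (≤ᵇ⇒≤ H H∞ (proj₂ both)) rankin }
    where
    open Uniform U
    both : T (C ≤ᵇ C∞) × T (H ≤ᵇ H∞)
    both = Equivalence.to T-∧ ok
  run-sound {G} {K} {C∞} {H∞} (suc k) i C H b U ok = [ survivor , composite ] (T-if (test (2 + i)) ok)
    where
    survivor : T (test (2 + i)) × T (step C∞ H∞ k i C H (search 10 ((2 + i) * cube 16) b)) →
      Uniform G K (suc k + (2 + i)) C∞ H∞
    survivor (_ , ok′) = step-sound k i C H (search 10 ((2 + i) * cube 16) b) U ok′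
    composite : ¬ T (test (2 + i)) × T (run C∞ H∞ k (suc i) C H b) → Uniform G K (suc k + (2 + i)) C∞ H∞
    composite (¬s , ok′) = subst (λ n → Uniform G K n C∞ H∞) (+-suc k (2 + i))
      (run-sound k (suc i) C H b (uniform-skip (λ pp → ¬s (prime⇒test pp)) ≤-refl ≤-refl U) ok′)

  step-sound {G} {K} {C∞} {H∞} k i C H b U ok = subst (λ n → Uniform G K n C∞ H∞) (+-suc k (2 + i))
    (run-sound k (suc i) (nextC i C) (nextH i H b) b next (proj₂ checks′))
    where
    p v g : ℕ
    p = 2 + i
    v = suc i
    g = suc (16 * p ∸ suc b)
    checks = Equivalence.to (T-∧ {p * cube 16 ≤ᵇ cube b}) ok
    checks′ = Equivalence.to (T-∧ {b <ᵇ 16 * p}) (proj₂ checks)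
    root : p * cube 16 ≤ cube b
    root = ≤ᵇ⇒≤ (p * cube 16) (cube b) (proj₁ checks)
    g+b : g + b ≡ 16 * p
    g+b = trans (sym (+-suc (16 * p ∸ suc b) b)) (m∸n+n≡m (<ᵇ⇒< b (16 * p) (proj₁ checks′)))
    C≤ : C * (v * v + (3 * v + 2)) ≤ nextC i C * (v * v)
    C≤ = m≤⌈m/n⌉*n (C * (v * v + (3 * v + 2))) (v * v)
    H≤ : H * (16 * p) ≤ nextH i H b * g
    H≤ = m≤⌈m/n⌉*n (H * (16 * p)) g
    next : Uniform G K (suc p) (nextC i C) (nextH i H b)
    next with prime? p
    ... | yes pp = uniform-step pp C≤ 16 b g root g+b H≤ U
    -- A composite survivor: the frame is kept, and the new constants are at least the old ones.
    ... | no ¬pp = uniform-skip ¬pp (round-increases {C} {nextC i C} (m≤m+n (v * v) _) C≤)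
      (round-increases {H} {nextH i H b} (≤-trans (m≤m+n g b) (≤-reflexive g+b)) H≤) U

-- The computation runs through 2, ..., 12599 with K = 10⁶, starting from C = H = K and b = 20, just
-- below 16 times the cube root of 2. The result is C / K ≤ 3100 and H / K ≤ 260000, the latter
-- being 26 percent of the cube root of 10¹⁸.
uniform-12600 : ∀ G → Uniform G 1000000 12600 3100000000 260000000000
uniform-12600 G = Certificate.run-sound survives prime⇒survives 12598 0 1000000 1000000 20 (initial-uniform G 1000000) _

-- The distorted phase

-- At most the proportion h / y is covered, so at least z / y is left; the last hypothesis says z /
-- y > (3/5) c / w, where `c` is at least C / K.
initial-potential : ∀ {K y z w c h N M M′ V C H} .{{_ : NonZero K}} →
  0 < N → N ≤ M → M ≤ M′ + V → K * y * V ≤ H * N →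
  H ≤ h * K → C ≤ c * K → h + z ≡ y → 3 * c * y < 5 * w * z →
  3 * (C * N) < 5 * (K * (w * M′))
initial-potential {K} {y} {z} {w} {c} {h} {N} {M} {M′} {V} {C} {H} N>0 N≤M M≤ V≤ H≤ C≤ h+z gap =
  *-cancelˡ-< y _ _ (begin-strict
    y * (3 * (C * N))              ≤⟨ *-monoʳ-≤ y (*-monoʳ-≤ 3 (*-monoˡ-≤ N C≤)) ⟩
    y * (3 * (c * K * N))          ≡⟨ r₁ y c K N ⟩
    K * N * (3 * c * y)            <⟨ *-monoʳ-< (K * N) {{m*n≢0 K N {{it}} {{>-nonZero N>0}}}} gap ⟩
    K * N * (5 * w * z)            ≡⟨ r₂ K N w z ⟩
    5 * (K * w) * (z * N)          ≤⟨ *-monoʳ-≤ (5 * (K * w)) zN≤ ⟩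
    5 * (K * w) * (y * M′)         ≡⟨ r₃ K w y M′ ⟩
    y * (5 * (K * (w * M′)))       ∎)
  where
  open ≤-Reasoning
  r₁ : ∀ y c K N → y * (3 * (c * K * N)) ≡ K * N * (3 * c * y)
  r₁ = solve-∀
  r₂ : ∀ K N w z → K * N * (5 * w * z) ≡ 5 * (K * w) * (z * N)
  r₂ = solve-∀
  r₃ : ∀ K w y M → 5 * (K * w) * (y * M) ≡ y * (5 * (K * (w * M)))
  r₃ = solve-∀
  r₄ : ∀ h K N → h * K * N ≡ K * (h * N)
  r₄ = solve-∀
  yV≤ : y * V ≤ h * N
  yV≤ = *-cancelˡ-≤ K (begin
    K * (y * V)     ≡⟨ *-assoc K y V ⟨
    K * y * V       ≤⟨ V≤ ⟩
    H * N           ≤⟨ *-monoˡ-≤ N H≤ ⟩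
    h * K * N       ≡⟨ r₄ h K N ⟩
    K * (h * N)     ∎)
  zN≤ : z * N ≤ y * M′
  zN≤ = +-cancelʳ-≤ (h * N) _ _ (begin
    z * N + h * N         ≡⟨ trans (+-comm (z * N) (h * N)) (sym (*-distribʳ-+ N h z)) ⟩
    (h + z) * N           ≡⟨ cong (_* N) h+z ⟩
    y * N                 ≤⟨ *-monoʳ-≤ y (≤-trans N≤M M≤) ⟩
    y * (M′ + V)          ≡⟨ *-distribˡ-+ y M′ V ⟩
    y * M′ + y * V        ≤⟨ +-monoʳ-≤ (y * M′) yV≤ ⟩
    y * M′ + h * N        ∎)

module Escape {D : ℕ → Set} (D? : Decidable D) (r : ℕ → ℤ) (G : ℕ) where

  open System D? r

  -- `mass` is the invariant of `potential-step` with w = `#coprime210 n`: relative to `N`, the mass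
  -- left exceeds (3/5) (C / K) / w.
  record Distorted (n : ℕ) : Set where
    field
      frame  : Frame G n
      μ      : Measure
      N C K  : ℕ
      avoids : Avoids μ (L frame)
      moment : Moment μ (L frame) N C K
      mass   : 3 * (C * N) < 5 * (K * (#coprime210 n * E μ (λ _ → 1)))

  module Clearing (L : List ℕ) where

    covered clear : ℕ → ℕ
    covered x = 𝟙 (any? (Hit? x) L)
    clear x = 1 ∸ covered x

    covered≤1 : ∀ x → covered x ≤ 1
    covered≤1 x = 𝟙≤1 (any? (Hit? x) L)

    clear-avoids : ∀ μ → Avoids (reweigh clear μ) L
    clear-avoids μ wx∈ w≢0 d∈ h with (w , x) , _ , refl ← ∈-map⁻ _ wx∈ =
      w≢0 (trans (cong (λ c → w * (1 ∸ c)) (𝟙-yes (any? (Hit? x) L) (lose d∈ h))) (*-zeroʳ w))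

    clear-moment : ∀ {μ N C K} → Moment μ L N C K → Moment (reweigh clear μ) L N C K
    clear-moment {μ} {N} {C} {K} h r₁ r₂ = ≤-trans
      (*-monoʳ-≤ K (≤-trans (≤-reflexive (E-reweigh clear μ _))
        (E-mono μ (λ x → ≤-trans (*-monoˡ-≤ _ (m∸n≤m 1 (covered x))) (≤-reflexive (*-identityˡ _))))))
      (h r₁ r₂)

    clear-mass : ∀ μ → E μ (λ _ → 1) ≤ E (reweigh clear μ) (λ _ → 1) + E μ covered
    clear-mass μ = begin
      E μ (λ _ → 1)                                             ≤⟨ E-mono μ (λ x → ≤-reflexive (split x)) ⟩
      E μ (λ x → clear x * 1 + covered x)                       ≡⟨ E-+ μ _ _ ⟩
      E μ (λ x → clear x * 1) + E μ covered                     ≡⟨ cong (_+ E μ covered) (sym (E-reweigh clear μ _)) ⟩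
      E (reweigh clear μ) (λ _ → 1) + E μ covered               ∎
      where
      open ≤-Reasoning
      split : ∀ x → 1 ≡ clear x * 1 + covered x
      split x = sym (trans (cong (_+ covered x) (*-identityʳ (clear x))) (m∸n+n≡m (covered≤1 x)))

    -- All moduli in `D` are at least y³, so the union bound is dominated by the Rankin sum with `s`
    -- = 1.
    covered-rankin : ∀ {μ N H J} y → (∀ {d} → D d → cube y ≤ d * cube 1) → Rankin μ L N H J →
      J * y * E μ covered ≤ H * N
    covered-rankin {μ} {N} {H} {J} y large h = begin
      J * y * E μ covered
        ≤⟨ *-monoʳ-≤ (J * y) (E-mono μ (λ x → ≤-trans (𝟙-any (Hit? x) L) (∑-mono L (pointwise x)))) ⟩
      J * y * E μ (λ x → ∑ L (λ d → 𝟙 (cube y ≤? d * cube 1) * χ d (r d) x))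
        ≡⟨ cong (J * y *_) (trans (E-∑ μ L _) (∑-cong L (λ d → E-*ˡ μ (𝟙 (cube y ≤? d * cube 1)) _))) ⟩
      J * y * ∑ L (λ d → 𝟙 (cube y ≤? d * cube 1) * E μ (χ d (r d)))
        ≤⟨ h r 1 y ⟩
      H * N * 1
        ≡⟨ *-identityʳ (H * N) ⟩
      H * N ∎
      where
      open ≤-Reasoning
      pointwise : ∀ x d → 𝟙 (Hit? x d) ≤ 𝟙 (cube y ≤? d * cube 1) * χ d (r d) x
      pointwise x d = ≤1⇒≤* (𝟙≤1 (Hit? x d))
        (𝟙-mono (Hit? x d) (cube y ≤? d * cube 1) (λ hit → large (proj₁ hit)))
        (𝟙-mono (Hit? x d) (_ ∣? _) proj₂)

  clear-uniform : ∀ {K n C H y z c h} .{{_ : NonZero K}} →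
    (∀ {d} → D d → cube y ≤ d * cube 1) →
    H ≤ h * K → C ≤ c * K → h + z ≡ y → 3 * c * y < 5 * #coprime210 n * z →
    Uniform G K n C H → Distorted n
  clear-uniform {K} {n} {C} {H} {y} {c = c} large H≤ C≤ h+z gap U = record
    { frame = frame
    ; μ = reweigh clear μ
    ; N = N
    ; C = C
    ; K = K
    ; avoids = clear-avoids μ
    ; moment = clear-moment {μ} {N} {C} {K} moment
    ; mass = initial-potential {y = y} {w = #coprime210 n} {c = c} {M = E μ (λ _ → 1)} {V = E μ covered} {H = H} N>0 mass (clear-mass μ)
        (covered-rankin {μ} {N} {H} {K} y large rankin) H≤ C≤ h+z gap
    }
    where
    open Uniform U
    open Clearing (L frame)

  distorted-skip : ∀ {n} → ¬ Prime n → Distorted n → Distorted (suc n)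
  distorted-skip {n} ¬pn S = record
    { frame = skip-frame ¬pn frame
    ; μ = μ
    ; N = N
    ; C = C
    ; K = K
    ; avoids = avoids
    ; moment = moment
    -- The count `#coprime210` does not decrease, so the requirement only weakens.
    ; mass = <-≤-trans mass (*-monoʳ-≤ 5 (*-monoʳ-≤ K (*-monoˡ-≤ (E μ (λ _ → 1)) (m≤n+m (#coprime210 n) (if coprime210 n then 1 else 0)))))
    }
    where open Distorted S

  distorted-step : ∀ {v} → 12599 ≤ v → Prime (suc v) → Distorted (suc v) → Distorted (suc (suc v))
  distorted-step {v} v≥ pp S = record
    { frame = extend-frame pp frame
    ; μ = distort μ
    ; N = N * (5 * q * q)
    ; C = C * (5 * (v * v) + 6 * (3 * v + 2))
    ; K = K * (5 * (v * v))
    ; avoids = distort-avoids avoids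
    ; moment = distort-moment {μ} {N} {C} {K} moment
    ; mass = subst (λ w → 3 * (C * (5 * (v * v) + 6 * (3 * v + 2)) * (N * (5 * q * q))) < 5 * (K * (5 * (v * v)) * (w * E (distort μ) (λ _ → 1))))
        (sym count)
        (potential-step C K N (E μ (λ _ → 1)) (E (distort μ) (λ _ → 1)) (E μ (λ y → #hit y * #hit y)) q (v * v)
          (6 * (3 * v + 2)) (#coprime210 (suc v)) {{m^n≢0 (suc v) G}} {{v²≢0}}
          mass (distort-mass μ) (#hit²-moment {μ} {N} {C} {K} moment) (potential-gap v v≥))
    }
    where
    open Distorted S
    open Distortion {v} {Q frame} pp (fresh-prime frame pp) G {L frame} (L∣Q frame)
    q = suc v ^ G
    7<p : 7 < suc v
    7<p = s≤s (≤-trans (toWitness {a? = 7 ≤? 12599} _) v≥)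
    count : #coprime210 (suc (suc v)) ≡ suc (#coprime210 (suc v))
    count = cong (λ b → (if b then 1 else 0) + #coprime210 (suc v)) (prime⇒coprime210 pp 7<p)
    v²≢0 : NonZero (v * v)
    v²≢0 = m*n≢0 v v {{v≢0}} {{v≢0}}
      where
      v≢0 : NonZero v
      v≢0 = >-nonZero (≤-trans (toWitness {a? = 1 ≤? 12599} _) v≥)

  distorted : ∀ {v} → 12599 ≤ v → Distorted (suc v) → ∀ k → Distorted (k + suc v)
  distorted v≥ S zero    = S
  distorted {v} v≥ S (suc k) with prime? (k + suc v)
  ... | no ¬pp = distorted-skip ¬pp (distorted v≥ S k)
  ... | yes pp = subst (λ n → Distorted (suc n)) (sym (+-suc k v))
    (distorted-step (≤-trans v≥ (m≤n+m v k)) (subst Prime (+-suc k v) pp)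
      (subst Distorted (+-suc k v) (distorted v≥ S k)))

  -- Once `n` exceeds the largest modulus, every modulus lies in the frame. In a cover no point
  -- could then carry weight, but the invariant forces positive mass.
  not-covered : (∀ {d} → D d → d ≤ G) → (∀ {d} → D d → NonZero d) →
    ∀ {n} → G < n → Distorted n → ¬ (∀ x → ∃[ d ] Hit d x)
  not-covered D≤G D≢0 {n} G<n S cover = <⇒≱ mass (≤-trans (≤-reflexive E≡0) z≤n)
    where
    open Distorted S
    D⊆L : ∀ {d} → D d → d ∈ L frame
    D⊆L {d} Dd = complete frame d {{D≢0 Dd}} (D≤G Dd) (λ _ p∣d →
      ≤-<-trans (∣⇒≤ {{D≢0 Dd}} p∣d) (≤-<-trans (D≤G Dd) G<n))
    weightless : ∀ {w x} → (w , x) ∈ μ → w ≡ 0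
    weightless {w} {x} wx∈ with w ≟ 0
    ... | yes w≡0 = w≡0
    ... | no  w≢0 with d , hit ← cover x = contradiction hit (avoids wx∈ w≢0 (D⊆L (proj₁ hit)))
    E₁≡0 : E μ (λ _ → 1) ≡ 0
    E₁≡0 = n≤0⇒n≡0 (≤-trans (∑-mono-∈ μ {g = λ _ → 0} (λ {(w , x)} wx∈ → ≤-reflexive (cong (_* 1) (weightless wx∈))))
      (≤-reflexive (∑-zero μ)))
    E≡0 : 5 * (K * (#coprime210 n * E μ (λ _ → 1))) ≡ 0
    E≡0 = trans (cong (λ z → 5 * (K * (#coprime210 n * z))) E₁≡0)
      (trans (cong (λ z → 5 * (K * z)) (*-zeroʳ (#coprime210 n))) (cong (5 *_) (*-zeroʳ K)))

  large-moduli-do-not-cover : (∀ {d} → D d → d ≤ G) → (∀ {d} → D d → 10 ^ 18 < d) → ¬ (∀ x → ∃[ d ] Hit d x)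
  large-moduli-do-not-cover D≤G large = not-covered D≤G (λ Dd → >-nonZero (≤-<-trans z≤n (large Dd)))
    (m<m+n G (s≤s z≤n))
    (distorted {12599} ≤-refl start G)
    where
    start : Distorted 12600
    -- Here y³ = 10¹⁸ and `#coprime210 12600` is 60 · 48 = 2880; the evaluated inequality is 3 ·
    -- 3100 · 10⁶ < 5 · 2880 · 740000.
    start = clear-uniform {y = 1000000} {z = 740000} {c = 3100} {h = 260000}
      (λ Dd → ≤-trans (<⇒≤ (large Dd)) (≤-reflexive (sym (*-identityʳ _))))
      ≤-refl ≤-refl refl (≤ᵇ⇒≤ _ _ _) (uniform-12600 G)

-- Distinct covering systems

theorem1 : (n : ℕ) → (m : Fin (suc n) → ℕ) → (a : Fin (suc n) → ℤ) →
    1 < m zero → StrictlyIncreasing m → Covers m a →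
    m zero ≤ 10 ^ 18
theorem1 n m a _ increasing covers = ≮⇒≥ (λ large →
  large-moduli-do-not-cover (λ { (j , refl) → m≤last j }) (λ { (j , refl) → <-≤-trans large (first≤m j) }) covered)
  where
  D : ℕ → Set
  D d = ∃[ j ] m j ≡ d
  D? : Decidable D
  D? d = Fin.any? (λ j → m j ≟ d)
  residue : ∀ {d} → Dec (D d) → ℤ
  residue (yes (j , _)) = a j
  -- A default value; as `Hit` asks for `D d`, it adds no progression.
  residue (no  _)       = pos 0
  r : ℕ → ℤ
  r d = residue (D? d)
  -- The largest modulus serves as the bound `G` on the exponents.
  open Escape D? r (m (fromℕ n))
  open System D? r
  first≤m : ∀ j → m zero ≤ m j
  first≤m zero        = ≤-refl
  first≤m (Fin.suc j) = <⇒≤ (increasing zero (Fin.suc j) (s≤s z≤n))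
  m≤last : ∀ j → m j ≤ m (fromℕ n)
  m≤last j with j Fin.≟ fromℕ n
  ... | yes refl = ≤-refl
  ... | no  j≢   = <⇒≤ (increasing j (fromℕ n) (Fin.≤∧≢⇒< (Fin.≤fromℕ j) j≢))
  -- Distinctness of the moduli makes the residue a function of the modulus.
  injective : ∀ i j → m i ≡ m j → i ≡ j
  injective i j eq with Fin.<-cmp i j
  ... | tri< i<j _ _ = contradiction eq (<⇒≢ (increasing i j i<j))
  ... | tri≈ _ i≡j _ = i≡j
  ... | tri> _ _ j<i = contradiction (sym eq) (<⇒≢ (increasing j i j<i))
  residue-m : ∀ j (dec : Dec (D (m j))) → residue dec ≡ a j
  residue-m j (yes (i , eq)) = cong a (injective i j eq)
  residue-m j (no  ∉D)       = contradiction (j , refl) ∉D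
  covered : ∀ x → ∃[ d ] Hit d x
  covered x with j , h ← covers (pos x) =
    m j , (j , refl) , subst (λ z → m j ∣ ℤ.∣ pos x ℤ.- z ∣) (sym (residue-m j (D? (m j)))) h
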